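{- Let $T$ be a permutation tableau of length $n$, let $\pi=\pi_1\pi_2\cdots\pi_n=\xi(T)$ be the permutation of $[n]$ associated with $T$ by the Corteel–Nadeau bijection $\xi$, and let $\bar{\pi}=(n+1-\pi_n,\ldots,n+1-\pi_2,n+1-\pi_1)$ be the reverse complement of $\pi$. Then $$\mathrm{inv}(T)=f_{32\text{ -- }1}(\bar{\pi}),$$ where $f_{32\text{ -- }1}(\sigma)$ denotes the number of pairs $(i,k)$ with $2\le i<k\le n$ and $\sigma_{i-1}>\sigma_i>\sigma_k$.
   Context: A permutation tableau of length $n$ is a Ferrers diagram (left-justified rows of weakly decreasing length from top to bottom; rows of length $0$ are allowed, and every column is nonempty) with $r$ rows and $c$ columns, $r+c=n$, whose cells are filled with $0$'s and $1$'s such that (i) each column contains at least one $1$, and (ii) there is no $0$ that has a $1$ above it in its column and a $1$ to its left in its row. The boundary path of the diagram from the top-right corner to the bottom-left corner consists of $n$ unit steps, labeled $1,\ldots,n$ in this order; a vertical step is the right end of a row and gives that row its label, a horizontal step is the bottom of a column and gives that column its label. $(i,j)$ denotes the cell in the row labeled $i$ and the column labeled $j$ (it exists iff $i<j$). A larger row label means a lower row; a larger column label means a column further to the left. A $0$ is restricted if there is a $1$ above it in its column. A row is unrestricted if it contains no restricted $0$ (e.g. empty rows). In each column the topmost $1$ is called a black dot, labeled by its column label; in each row containing a restricted $0$, the rightmost restricted $0$ is called a white dot, labeled by its row label. So each column label and each label of a non-unrestricted row is the label of exactly one dot. Alternating paths: for a dot $d$, the alternating path starting at $d$ is the sequence of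 dots $d=d_1,d_2,\ldots$ where: if $d_m$ is a white dot in column $j$, then $d_{m+1}$ is the black dot of column $j$; if $d_m$ is a black dot in a row $i$ that is not unrestricted, then $d_{m+1}$ is the white dot of row $i$; if $d_m$ is a black dot in an unrestricted row, the path ends at $d_m$. Every alternating path ends at a black dot in an unrestricted row. For a label $k$ of a dot, $P_k$ denotes the alternating path starting at the dot labeled $k$. A path $P$ contains a path $Q$ if $Q$ is a segment (final segment) of $P$. Order on paths: let $P,Q$ be alternating paths neither of which contains the other. If $P,Q$ have no common dot, then $P>Q$ if the ending dot of $P$ is in a lower row than the ending dot of $Q$, or in the same row and to the right of it; otherwise $P<Q$. If $P,Q$ have a common dot, they coincide from their first common dot on; let $P',Q'$ be obtained by deleting the common dots, and set $P>Q$ if the ending dot of $P'$ is below, or to the right of, the ending dot of $Q'$ (these two dots lie in a common column or a common row), and $P<Q$ otherwise. Inversions: for a column label $j$ of $T$ and a label $k>j$ of a dot such that $k$ is not the label of a dot on $P_j$, the pair $(j,k)$ is an inversion of $T$ if $P_j>P_k$. $\mathrm{inv}(T)$ is the number of inversions. The bijection $\xi$: start with the labels of the unrestricted rows in increasing order. Then process the column labels $j$ in decreasing order: if the black dot of column $j$ is in cell $(i,j)$, insert $j$ immediately to the left of $i$; then, if column $j$ contains white dots in rows $i_1<i_2<\cdots<i_k$, insert $i_1,i_2,\ldots,i_k$ in increasing order immediately to the left of $j$. The final word is $\xi(T)$. -}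

module Defs where

open import Data.Bool using (Bool; true; false; _∧_; _∨_; not; if_then_else_)
open import Data.Nat using (ℕ; zero; suc; _≤_; _<_; _∸_; _<ᵇ_; _≡ᵇ_)
open import Data.List using (List; []; _∷_; map; upTo; reverse; length; drop; foldl)
open import Data.Maybe using (Maybe; just; nothing)
open import Data.Product using (_×_; _,_; ∃-syntax)
open import Data.Empty using (⊥)
open import Relation.Binary.PropositionalEquality using (_≡_)

labels : ℕ → List ℕ
labels n = map suc (upTo n)

countB : {A : Set} → (A → Bool) → List A → ℕ
countB p []       = 0
countB p (x ∷ xs) = if p x then suc (countB p xs) else countB p xs

firstB : (ℕ → Bool) → List ℕ → ℕ
firstB p []       = 0
firstB p (x ∷ xs) = if p x then x else firstB p xs

anyB : (ℕ → Bool) → List ℕ → Bool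
anyB p []       = false
anyB p (x ∷ xs) = p x ∨ anyB p xs

elemB : ℕ → List ℕ → Bool
elemB x = anyB (λ y → x ≡ᵇ y)

eqListB : List ℕ → List ℕ → Bool
eqListB []       []       = true
eqListB (x ∷ xs) (y ∷ ys) = (x ≡ᵇ y) ∧ eqListB xs ys
eqListB _        _        = false

sumL : List ℕ → ℕ
sumL []       = 0
sumL (x ∷ xs) = x Data.Nat.+ sumL xs

filterB : (ℕ → Bool) → List ℕ → List ℕ
filterB p []       = []
filterB p (x ∷ xs) = if p x then x ∷ filterB p xs else filterB p xs

lastOr0 : List ℕ → ℕ
lastOr0 []           = 0
lastOr0 (x ∷ [])     = x
lastOr0 (x ∷ y ∷ ys) = lastOr0 (y ∷ ys)

takeWhileB : (ℕ → Bool) → List ℕ → List ℕ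
takeWhileB p []       = []
takeWhileB p (x ∷ xs) = if p x then x ∷ takeWhileB p xs else []

insertBefore : ℕ → ℕ → List ℕ → List ℕ
insertBefore x y []       = []
insertBefore x y (z ∷ zs) = if z ≡ᵇ y then x ∷ z ∷ zs else z ∷ insertBefore x y zs

at : List ℕ → ℕ → ℕ
at []       _             = 0
at (x ∷ xs) zero          = 0
at (x ∷ xs) (suc zero)    = x
at (x ∷ xs) (suc (suc k)) = at xs (suc k)

-- Permutation tableaux of length n.
-- The boundary path has steps labelled 1..n; isRow k = true iff step k
-- is vertical (k is a row label), false iff it is horizontal (k is a
-- column label).  fill i j is the entry of cell (i,j); only its values
-- on actual cells are ever used.

record PermTableau (n : ℕ) : Set where
  field
    isRow : ℕ → Bool
    fill  : ℕ → ℕ → Bool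

  IsCell : ℕ → ℕ → Set
  IsCell i j = (1 ≤ i) × (i < j) × (j ≤ n) × (isRow i ≡ true) × (isRow j ≡ false)

  field
    columnHasOne : ∀ j → 1 ≤ j → j ≤ n → isRow j ≡ false →
                   ∃[ i ] (IsCell i j × fill i j ≡ true)
    -- no 0 with a 1 above it in its column and a 1 to its left in its row
    noBadZero : ∀ i j i′ j′ → IsCell i j → fill i j ≡ false →
                IsCell i′ j → i′ < i → fill i′ j ≡ true →
                IsCell i j′ → j < j′ → fill i j′ ≡ true → ⊥

module _ {n : ℕ} (T : PermTableau n) where
  open PermTableau T

  isCellB : ℕ → ℕ → Bool
  isCellB i j = isRow i ∧ not (isRow j) ∧ (i <ᵇ j)

  oneAt : ℕ → ℕ → Bool
  oneAt i j = isCellB i j ∧ fill i j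

  restrictedZero : ℕ → ℕ → Bool
  restrictedZero i j = isCellB i j ∧ not (fill i j) ∧
                       anyB (λ i′ → (i′ <ᵇ i) ∧ oneAt i′ j) (labels n)

  unrestrictedRow : ℕ → Bool
  unrestrictedRow i = not (anyB (λ j → restrictedZero i j) (labels n))

  -- row of the black dot of column j (topmost 1 = smallest row label)
  blackRow : ℕ → ℕ
  blackRow j = firstB (λ i → oneAt i j) (labels n)

  -- column of the white dot of row i (rightmost restricted 0 = smallest column label)
  whiteCol : ℕ → ℕ
  whiteCol i = firstB (λ j → restrictedZero i j) (labels n)

  -- k is the label of a dot: a column label (black dot), or the label of a
  -- row that is not unrestricted (white dot)
  isDotLabel : ℕ → Bool
  isDotLabel k = not (isRow k) ∨ not (unrestrictedRow k)

  dotPos : ℕ → ℕ × ℕ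
  dotPos k = if isRow k then (k , whiteCol k) else (blackRow k , k)

  nextDot : ℕ → Maybe ℕ
  nextDot k = if isRow k
              then just (whiteCol k)
              else (if unrestrictedRow (blackRow k) then nothing else just (blackRow k))

  pathFuel : ℕ → ℕ → List ℕ
  pathFuel zero    k = []
  pathFuel (suc f) k with nextDot k
  ... | nothing = k ∷ []
  ... | just k′ = k ∷ pathFuel f k′

  -- the alternating path P_k, as the list of labels of its dots.
  -- (There are at most n dots and paths do not repeat dots, so fuel n+1
  -- always suffices to reach the end of the path.)
  path : ℕ → List ℕ
  path k = pathFuel (suc n) k

  containsB : List ℕ → List ℕ → Bool
  containsB P Q = (length Q Data.Nat.≤ᵇ length P) ∧ eqListB (drop (length P ∸ length Q) P) Q

  -- P > Q (for paths neither of which contains the other)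
  greaterB : List ℕ → List ℕ → Bool
  greaterB P Q with anyB (λ x → elemB x Q) P
  ... | false = let (a , b)  = dotPos (lastOr0 P)
                    (a′ , b′) = dotPos (lastOr0 Q)
                in (a′ <ᵇ a) ∨ ((a ≡ᵇ a′) ∧ (b <ᵇ b′))
  ... | true  = let P′ = takeWhileB (λ x → not (elemB x Q)) P
                    Q′ = takeWhileB (λ x → not (elemB x P)) Q
                    (a , b)  = dotPos (lastOr0 P′)
                    (a′ , b′) = dotPos (lastOr0 Q′)
                in (a′ <ᵇ a) ∨ (b <ᵇ b′)

  isInversion : ℕ → ℕ → Bool
  isInversion j k = not (isRow j) ∧ (j <ᵇ k) ∧ isDotLabel k ∧
                    not (elemB k (path j)) ∧
                    not (containsB (path j) (path k)) ∧
                    not (containsB (path k) (path j)) ∧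
                    greaterB (path j) (path k)

  inv : ℕ
  inv = sumL (map (λ j → countB (λ k → isInversion j k) (labels n)) (labels n))

  ξStep : List ℕ → ℕ → List ℕ
  ξStep w j = insertWhites (whiteRows j) (insertBefore j (blackRow j) w)
    where
      whiteRows : ℕ → List ℕ
      whiteRows j = filterB (λ i → isRow i ∧ not (unrestrictedRow i) ∧ (whiteCol i ≡ᵇ j)) (labels n)
      insertWhites : List ℕ → List ℕ → List ℕ
      insertWhites []       w = w
      insertWhites (i ∷ is) w = insertWhites is (insertBefore i j w)

  ξ : List ℕ
  ξ = foldl ξStep
            (filterB (λ i → isRow i ∧ unrestrictedRow i) (labels n))
            (filterB (λ j → not (isRow j)) (reverse (labels n)))

reverseComplement : ℕ → List ℕ → List ℕ
reverseComplement n π = map (λ x → suc n ∸ x) (reverse π)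

f32-1 : ℕ → List ℕ → ℕ
f32-1 n σ = sumL (map (λ i → countB (λ k → (2 Data.Nat.≤ᵇ i) ∧ (i <ᵇ k)
                                         ∧ (at σ i <ᵇ at σ (i ∸ 1)) ∧ (at σ k <ᵇ at σ i))
                                   (labels n))
                      (labels n))

{-# OPTIONS --safe #-}

-- Let the parent of a column be the row of its black dot, the parent of a restricted row the column of
-- its white dot, and the parent of an unrestricted row a virtual column n + 1.  The alternating paths are
-- then the ancestor chains of a tree in which the intervals [i , j] cut out by the dots (i , j) strictly
-- grow towards the root.  The word ξ(T) is the postorder reading of this tree, with the row children of a
-- column increasing and the column children of a row decreasing.  Comparing two alternating paths at the
-- place where they meet is comparing two siblings, so for a column j and a label k > j the pair (j , k) is
-- an inversion exactly when k precedes j in ξ(T).  Moreover each column is followed by a smaller entry and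
-- each row by a larger one (appending n + 1), so columns are the descent tops and inversions are the
-- occurrences of 3–21 in ξ(T), that is, of 32–1 in its reverse complement.
module Submission where

open import Defs
open import Data.Bool using (Bool; true; false; if_then_else_; not; _∧_; _∨_)
open import Data.Bool.Properties using (T-≡; ¬-not; ∧-conicalˡ; ∧-conicalʳ; not-injective) renaming (_≟_ to _≟ᵇ_)
open import Data.List using (List; []; _∷_; _++_; [_]; _∷ʳ_; applyUpTo; drop; filter; foldl; length; map; reverse; reverseAcc; take; upTo)
open import Data.List.Membership.Propositional using (_∈_; _∉_)
open import Data.List.Membership.Propositional.Properties using (∈-++⁺ˡ; ∈-++⁺ʳ; ∈-++⁻; ∈-filter⁺; ∈-filter⁻; ∈-map⁺; ∈-map⁻; ∈-upTo⁺; ∈-upTo⁻; ∈-∃++)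
open import Data.List.Membership.Propositional.Properties.WithK using (unique∧set⇒bag)
open import Data.List.Properties using (++-assoc; length-map; length-upTo; map-++; map-cong-local; map-upTo; map-∘; reverse-++; take++drop≡id; unfold-reverse; upTo-∷ʳ)
open import Data.List.Relation.Binary.BagAndSetEquality using (∼bag⇒↭)
open import Data.List.Relation.Binary.Permutation.Propositional as ↭ using (_↭_)
open import Data.List.Relation.Binary.Permutation.Propositional.Properties using (↭-length; ↭-reverse; ∈-resp-↭) renaming (map⁺ to ↭-map⁺)
open import Data.List.Relation.Unary.All as All using (All; []; _∷_)
import Data.List.Relation.Unary.All.Properties as All
open import Data.List.Relation.Unary.AllPairs as AllPairs using (AllPairs; []; _∷_)
import Data.List.Relation.Unary.AllPairs.Properties as AllPairs
open import Data.List.Relation.Unary.Any using (here; there)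
open import Data.List.Relation.Unary.Linked using (Linked; []; [-]; _∷_)
open import Data.Maybe using (just; nothing)
open import Data.Nat
open import Data.Nat.Properties
open import Data.Product using (∃-syntax; ∃₂; _×_; _,_; proj₁; proj₂)
open import Data.Sum using (_⊎_; inj₁; inj₂; map₁)
open import Data.Empty using (⊥-elim)
open import Function using (_∘_; flip; id; Equivalence; mk⇔)
open import Level using (0ℓ)
open import Relation.Binary using (Rel; tri<; tri≈; tri>)
open import Relation.Binary.PropositionalEquality hiding ([_])
open import Relation.Nullary using (¬_)
open import Relation.Nullary.Negation using (contradiction)

-- Labels, filtering and relations on lists.

Label : ℕ → ℕ → Set
Label n k = 1 ≤ k × k ≤ n

∈-labels⁺ : ∀ {n k} → Label n k → k ∈ labels n
∈-labels⁺ {k = suc k} (_ , k<n) = ∈-map⁺ suc (∈-upTo⁺ k<n)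

∈-labels⁻ : ∀ {n k} → k ∈ labels n → Label n k
∈-labels⁻ k∈ with ∈-map⁻ suc k∈
... | _ , l∈ , refl = s≤s z≤n , ∈-upTo⁻ l∈

labels-sorted : ∀ n → AllPairs _<_ (labels n)
labels-sorted n = AllPairs.map⁺ (AllPairs.applyUpTo⁺₁ id n (λ i<j _ → s≤s i<j))

reverse-labels : ∀ n → reverse (labels (suc n)) ≡ suc n ∷ reverse (labels n)
reverse-labels n = begin
  reverse (map suc (upTo (suc n)))   ≡⟨ cong (reverse ∘ map suc) (upTo-∷ʳ n) ⟨
  reverse (map suc (upTo n ∷ʳ n))    ≡⟨ cong reverse (map-++ suc (upTo n) [ n ]) ⟩
  reverse (labels n ∷ʳ suc n)        ≡⟨ reverse-++ (labels n) [ suc n ] ⟩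
  suc n ∷ reverse (labels n)         ∎
  where open ≡-Reasoning

filterB≗filter : ∀ p xs → filterB p xs ≡ filter (λ x → p x ≟ᵇ true) xs
filterB≗filter p []       = refl
filterB≗filter p (x ∷ xs) with p x
... | true  = cong (x ∷_) (filterB≗filter p xs)
... | false = filterB≗filter p xs

∈-filterB⁺ : ∀ {p x xs} → x ∈ xs → p x ≡ true → x ∈ filterB p xs
∈-filterB⁺ {p} {xs = xs} x∈ px rewrite filterB≗filter p xs = ∈-filter⁺ (λ x → p x ≟ᵇ true) x∈ px

∈-filterB⁻ : ∀ {p x xs} → x ∈ filterB p xs → x ∈ xs × p x ≡ true
∈-filterB⁻ {p} {xs = xs} x∈ rewrite filterB≗filter p xs = ∈-filter⁻ (λ x → p x ≟ᵇ true) x∈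

filterB-AllPairs : ∀ {R : Rel ℕ 0ℓ} p {xs} → AllPairs R xs → AllPairs R (filterB p xs)
filterB-AllPairs p {xs} rs rewrite filterB≗filter p xs = AllPairs.filter⁺ (λ x → p x ≟ᵇ true) rs

module _ {A : Set} {R : Rel A 0ℓ} where

  AllPairs-++-cross : ∀ u {w : List A} → AllPairs R (u ++ w) → All (λ a → All (R a) w) u
  AllPairs-++-cross []      _         = []
  AllPairs-++-cross (a ∷ u) (ra ∷ rs) = All.++⁻ʳ u ra ∷ AllPairs-++-cross u rs

  AllPairs-++ˡ : ∀ u {w : List A} → AllPairs R (u ++ w) → AllPairs R u
  AllPairs-++ˡ []      _         = []
  AllPairs-++ˡ (a ∷ u) (ra ∷ rs) = All.++⁻ˡ u ra ∷ AllPairs-++ˡ u rs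

  AllPairs-++ʳ : ∀ u {w : List A} → AllPairs R (u ++ w) → AllPairs R w
  AllPairs-++ʳ []      rs       = rs
  AllPairs-++ʳ (a ∷ u) (_ ∷ rs) = AllPairs-++ʳ u rs

  Linked-++ʳ : ∀ u {w : List A} → Linked R (u ++ w) → Linked R w
  Linked-++ʳ []           rs       = rs
  Linked-++ʳ (a ∷ [])     [-]      = []
  Linked-++ʳ (a ∷ [])     (_ ∷ rs) = rs
  Linked-++ʳ (a ∷ b ∷ u)  (_ ∷ rs) = Linked-++ʳ (b ∷ u) rs

  -- An insertion in front of `x` breaks only the link from the last entry of `u` to `x`; that link
  -- is the one to be re-established.
  Linked-replace-tail : ∀ u {x y : A} {xs ys} → Linked R (u ++ x ∷ xs) →
                        (∀ {a} → a ∈ u → R a x → R a y) → Linked R (y ∷ ys) → Linked R (u ++ y ∷ ys)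
  Linked-replace-tail []          _        _ ls = ls
  Linked-replace-tail (a ∷ [])    (r ∷ _)  f ls = f (here refl) r ∷ ls
  Linked-replace-tail (a ∷ b ∷ u) (r ∷ rs) f ls = r ∷ Linked-replace-tail (b ∷ u) rs (f ∘ there) ls

-- Alternating trees and their intervals.

record AlternatingTree (n : ℕ) : Set where
  field
    isRow  : ℕ → Bool
    parent : ℕ → ℕ

  Row : ℕ → Set
  Row k = isRow k ≡ true

  Col : ℕ → Set
  Col k = isRow k ≡ false

  field
    -- The inequalities here and in `parent-row` are strict nestings: `[parent j , j]` grows to the
    -- right into `[parent j , parent (parent j)]`, and `[i , parent i]` grows to the left into
    -- `[parent (parent i) , parent i]`.
    parent-col : ∀ {j} → Label n j → Col j →
                 Label n (parent j) × Row (parent j) × parent j < j × j < parent (parent j)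
    parent-row : ∀ {i} → Label n i → Row i →
                 i < parent i ×
                 (parent i ≡ suc n ⊎ Label n (parent i) × Col (parent i) × parent (parent i) < i)

module Postorder {n} (tree : AlternatingTree n) where
  open AlternatingTree tree public

  Col⇒¬Row : ∀ {k} → Col k → ¬ Row k
  Col⇒¬Row c r with () ← trans (sym c) r

  row⊎col : ∀ k → Row k ⊎ Col k
  row⊎col k with isRow k
  ... | true  = inj₁ refl
  ... | false = inj₂ refl

  -- The dot labelled `k` sits in cell `(lo k , hi k)`. An unrestricted row gets the interval up to
  -- the virtual column `suc n`.
  lo hi width : ℕ → ℕ
  lo k = if isRow k then k else parent k
  hi k = if isRow k then parent k else k
  width k = hi k ∸ lo k

  lo-row : ∀ {k} → Row k → lo k ≡ k
  lo-row r rewrite r = refl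

  hi-row : ∀ {k} → Row k → hi k ≡ parent k
  hi-row r rewrite r = refl

  lo-col : ∀ {k} → Col k → lo k ≡ parent k
  lo-col c rewrite c = refl

  hi-col : ∀ {k} → Col k → hi k ≡ k
  hi-col c rewrite c = refl

  lo≤ : ∀ {k} → Label n k → lo k ≤ k
  lo≤ {k} l with row⊎col k
  ... | inj₁ r rewrite r = ≤-refl
  ... | inj₂ c rewrite c = let _ , _ , p<k , _ = parent-col l c in <⇒≤ p<k

  ≤hi : ∀ {k} → Label n k → k ≤ hi k
  ≤hi {k} l with row⊎col k
  ... | inj₁ r rewrite r = <⇒≤ (proj₁ (parent-row l r))
  ... | inj₂ c rewrite c = ≤-refl

  parent-row-label : ∀ {i} → Label n i → Row i → Label n (parent i) → Col (parent i) × parent (parent i) < i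
  parent-row-label l r lp with proj₂ (parent-row l r)
  ... | inj₁ p≡ = contradiction (subst (_≤ n) p≡ (proj₂ lp)) 1+n≰n
  ... | inj₂ (_ , c , p<) = c , p<

  child-of-row : ∀ {k} → Label n k → Label n (parent k) → Row (parent k) → Col k
  child-of-row {k} l lp rp with row⊎col k
  ... | inj₁ r = contradiction rp (Col⇒¬Row (proj₁ (parent-row-label l r lp)))
  ... | inj₂ c = c

  hi-parent : ∀ {k} → Label n k → Label n (parent k) → hi k ≤ hi (parent k)
  hi-parent {k} l lp with row⊎col k
  ... | inj₁ r rewrite hi-row r | hi-col (proj₁ (parent-row-label l r lp)) = ≤-refl
  ... | inj₂ c = let _ , r , _ , k<pp = parent-col l c in
                 subst₂ _≤_ (sym (hi-col c)) (sym (hi-row r)) (<⇒≤ k<pp)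

  lo-parent : ∀ {k} → Label n k → Label n (parent k) → lo (parent k) ≤ lo k
  lo-parent {k} l lp with row⊎col k
  ... | inj₁ r = let c , pp<k = parent-row-label l r lp in
                 subst₂ _≤_ (sym (lo-col c)) (sym (lo-row r)) (<⇒≤ pp<k)
  ... | inj₂ c rewrite lo-col c | lo-row (proj₁ (proj₂ (parent-col l c))) = ≤-refl

  width-parent : ∀ {k} → Label n k → Label n (parent k) → width k < width (parent k)
  width-parent {k} l lp with row⊎col k
  ... | inj₁ r = let c , pp<k = parent-row-label l r lp in
                 subst₂ _<_ (sym (cong₂ _∸_ (hi-row r) (lo-row r))) (sym (cong₂ _∸_ (hi-col c) (lo-col c)))
                   (∸-monoʳ-< pp<k (<⇒≤ (proj₁ (parent-row l r))))
  ... | inj₂ c = let _ , r , p<k , k<pp = parent-col l c in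
                 subst₂ _<_ (sym (cong₂ _∸_ (hi-col c) (lo-col c))) (sym (cong₂ _∸_ (hi-row r) (lo-row r)))
                   (∸-monoˡ-< k<pp (<⇒≤ p<k))

  -- The two ends of the interval of a dot lie between 1 and `n`. This bound later shows that a path
  -- cannot outrun its fuel.
  width<n : ∀ {k} → Label n k → Label n (parent k) → width k < n
  width<n {k} l lp with row⊎col k
  ... | inj₁ r = subst₂ (λ h m → h ∸ m < n) (sym (hi-row r)) (sym (lo-row r))
                   (<-≤-trans (∸-monoʳ-< (proj₁ l) (<⇒≤ (proj₁ (parent-row l r)))) (proj₂ lp))
  ... | inj₂ c = let (1≤p , _) , _ , p<k , _ = parent-col l c in
                 subst₂ (λ h m → h ∸ m < n) (sym (hi-col c)) (sym (lo-col c))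
                   (<-≤-trans (∸-monoʳ-< 1≤p (<⇒≤ p<k)) (proj₂ l))

  -- Ancestors, siblings and the postorder.

  infix 4 _⊑_ _⊏_ _≺_

  -- Every step ends at a genuine label, so no chain climbs to the virtual column above the
  -- unrestricted rows.
  data _⊑_ : ℕ → ℕ → Set where
    done : ∀ {a} → a ⊑ a
    up   : ∀ {a b} → Label n a → Label n (parent a) → parent a ⊑ b → a ⊑ b

  _⊏_ : ℕ → ℕ → Set
  a ⊏ b = Label n a × Label n (parent a) × parent a ⊑ b

  ⊑-trans : ∀ {a b c} → a ⊑ b → b ⊑ c → a ⊑ c
  ⊑-trans done        q = q
  ⊑-trans (up l lp p) q = up l lp (⊑-trans p q)

  ⊑-⊏-trans : ∀ {a b c} → a ⊑ b → b ⊏ c → a ⊏ c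
  ⊑-⊏-trans done        q            = q
  ⊑-⊏-trans (up l lp p) (lb , lq , q) = l , lp , ⊑-trans p (up lb lq q)

  ⊏⇒⊑ : ∀ {a b} → a ⊏ b → a ⊑ b
  ⊏⇒⊑ (l , lp , p) = up l lp p

  ⊑-label : ∀ {a b} → a ⊑ b → Label n a → Label n b
  ⊑-label done        l = l
  ⊑-label (up _ lp p) _ = ⊑-label p lp

  hi-mono : ∀ {a b} → a ⊑ b → hi a ≤ hi b
  hi-mono done        = ≤-refl
  hi-mono (up l lp p) = ≤-trans (hi-parent l lp) (hi-mono p)

  lo-anti : ∀ {a b} → a ⊑ b → lo b ≤ lo a
  lo-anti done        = ≤-refl
  lo-anti (up l lp p) = ≤-trans (lo-anti p) (lo-parent l lp)

  width-mono : ∀ {a b} → a ⊑ b → width a ≤ width b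
  width-mono done        = ≤-refl
  width-mono (up l lp p) = ≤-trans (<⇒≤ (width-parent l lp)) (width-mono p)

  ⊏-irrefl : ∀ {a} → ¬ a ⊏ a
  ⊏-irrefl (l , lp , p) = <-irrefl refl (<-≤-trans (width-parent l lp) (width-mono p))

  -- Ancestors form a chain because `parent` is a function: two climbs from the same label agree as
  -- long as both last.
  ⊑-comparable : ∀ {a b c} → a ⊑ b → a ⊑ c → b ⊑ c ⊎ c ⊑ b
  ⊑-comparable done          q             = inj₁ q
  ⊑-comparable p             done          = inj₂ p
  ⊑-comparable (up _ _ p) (up _ _ q) = ⊑-comparable p q

  -- The earlier sibling comes first. Unrestricted rows share the parent `suc n` and so fall under
  -- `rows`, which makes the forest behave like one tree.
  data Sibling : ℕ → ℕ → Set where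
    rows : ∀ {x y} → Row x → Row y → parent x ≡ parent y → x < y → Sibling x y
    cols : ∀ {x y} → Col x → Col y → parent x ≡ parent y → y < x → Sibling x y

  Sibling-parent : ∀ {x y} → Sibling x y → parent x ≡ parent y
  Sibling-parent (rows _ _ p≡ _) = p≡
  Sibling-parent (cols _ _ p≡ _) = p≡

  Sibling-irrefl : ∀ {x} → ¬ Sibling x x
  Sibling-irrefl (rows _ _ _ x<x) = <-irrefl refl x<x
  Sibling-irrefl (cols _ _ _ x<x) = <-irrefl refl x<x

  -- A proper climb from `x` to `y` starts with the common parent, which would then lie both above
  -- and below `y`; strict growth of the widths forbids this.
  Sibling-incomparable : ∀ {x y} → Sibling x y ⊎ Sibling y x → ¬ x ⊑ y
  Sibling-incomparable (inj₁ s) done = Sibling-irrefl s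
  Sibling-incomparable (inj₂ s) done = Sibling-irrefl s
  Sibling-incomparable {x} {y} s (up l lp p) =
    ⊏-irrefl (⊑-label p lp , subst (λ c → Label n c × c ⊑ y) (p≡ s) (lp , p))
    where
      p≡ : Sibling x y ⊎ Sibling y x → parent x ≡ parent y
      p≡ (inj₁ s) = Sibling-parent s
      p≡ (inj₂ s) = sym (Sibling-parent s)

  Sibling-disjoint : ∀ {x y a} → Sibling x y → a ⊑ x → ¬ a ⊑ y
  Sibling-disjoint s p q with ⊑-comparable p q
  ... | inj₁ r = Sibling-incomparable (inj₁ s) r
  ... | inj₂ r = Sibling-incomparable (inj₂ s) r

  -- a ≺ b: a precedes b in the postorder reading of the tree.
  data _≺_ : ℕ → ℕ → Set where
    descend : ∀ {a b} → a ⊏ b → a ≺ b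
    branch  : ∀ {a b x y} → a ⊑ x → b ⊑ y → Sibling x y → a ≺ b

  ≺-irrefl : ∀ {a} → ¬ a ≺ a
  ≺-irrefl (descend p)    = ⊏-irrefl p
  ≺-irrefl (branch p q s) = Sibling-disjoint s p q

  ⊑-≺-trans : ∀ {a b c} → a ⊑ b → b ≺ c → a ≺ c
  ⊑-≺-trans p (descend q)    = descend (⊑-⊏-trans p q)
  ⊑-≺-trans p (branch q r s) = branch (⊑-trans p q) r s

  -- This finds the child of `b` whose subtree holds `a`, so that it can be compared with another
  -- child of `b`.
  ⊏-last : ∀ {a b} → a ⊏ b → ∃[ c ] a ⊑ c × Label n c × parent c ≡ b
  ⊏-last {a} {b} (l , _ , p) = go l p
    where
      go : ∀ {a} → Label n a → parent a ⊑ b → ∃[ c ] a ⊑ c × Label n c × parent c ≡ b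
      go l done         = _ , done , l , refl
      go l (up l′ _ p) = let c , q , lc , p≡ = go l′ p in c , up l l′ q , lc , p≡

  -- The invariant of the insertion procedure.

  infix 4 _⋖_

  -- The relation between consecutive entries: columns are exactly the descent tops.
  _⋖_ : ℕ → ℕ → Set
  a ⋖ b = Row a × a < b ⊎ Col a × b < a

  -- The invariant of ξ once the columns > m are inserted; hi k is the column at whose step k enters the word.
  record Stage (m : ℕ) (w : List ℕ) : Set where
    field
      complete : ∀ {k} → Label n k → m < hi k → k ∈ w
      sound    : ∀ {k} → k ∈ w → Label n k × m < hi k
      ordered  : AllPairs _≺_ w
      linked   : Linked _⋖_ (w ∷ʳ suc n)
  open Stage public

  Row-linked : ∀ {is z zs} → All (λ x → Row x × x < z) is → AllPairs _<_ is →
               Linked _⋖_ (z ∷ zs) → Linked _⋖_ (is ++ z ∷ zs)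
  Row-linked []                   _                   ls = ls
  Row-linked ((r , x<z) ∷ [])     _                   ls = inj₁ (r , x<z) ∷ ls
  Row-linked ((r , _) ∷ rs@(_ ∷ _)) ((x<y ∷ _) ∷ <s) ls = inj₁ (r , x<y) ∷ Row-linked rs <s ls

  sorted-siblings : ∀ {is} → (∀ {x y} → x ∈ is → y ∈ is → x < y → Sibling x y) → AllPairs _<_ is → AllPairs _≺_ is
  sorted-siblings f []         = []
  sorted-siblings f (<x ∷ <s) =
    All.tabulate (λ y∈ → branch done done (f (here refl) (there y∈) (All.lookup <x y∈)))
      ∷ sorted-siblings (λ x∈ y∈ → f (there x∈) (there y∈)) <s

  -- A column has itself as `hi` and a restricted row has a column there, both at most `n`; hence
  -- only the unrestricted rows are due at the start.
  stage-init : ∀ {is} → (∀ {k} → Label n k → Row k → parent k ≡ suc n → k ∈ is) →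
               (∀ {k} → k ∈ is → Label n k × Row k × parent k ≡ suc n) → AllPairs _<_ is → Stage n is
  stage-init {is} ⊇ ⊆ <s = record
    { complete = λ l n<hi → compl l n<hi
    ; sound    = λ k∈ → let l , r , p≡ = ⊆ k∈ in l , ≤-reflexive (sym (trans (hi-row r) p≡))
    ; ordered  = sorted-siblings (λ x∈ y∈ x<y → let _ , r , p≡ = ⊆ x∈ ; _ , r′ , p≡′ = ⊆ y∈ in
                                   rows r r′ (trans p≡ (sym p≡′)) x<y) <s
    ; linked   = Row-linked (All.tabulate λ k∈ → let (_ , k≤n) , r , _ = ⊆ k∈ in r , s≤s k≤n) <s Linked.[-]
    }
    where
      compl : ∀ {k} → Label n k → n < hi k → k ∈ is
      compl {k} l n<hi with row⊎col k
      ... | inj₂ c = contradiction (subst (n <_) (hi-col c) n<hi) (≤⇒≯ (proj₂ l))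
      ... | inj₁ r with proj₂ (parent-row l r)
      ...   | inj₁ p≡            = ⊇ l r p≡
      ...   | inj₂ ((_ , p≤) , _) = contradiction (subst (n <_) (hi-row r) n<hi) (≤⇒≯ p≤)

  -- Each `hi k` is a column or `suc n`, so no label enters at a row label and lowering the
  -- threshold past it changes nothing.
  stage-row : ∀ {m w} → Label n (suc m) → Row (suc m) → Stage (suc m) w → Stage m w
  stage-row {m} (_ , j≤n) r st = record
    { complete = λ l m<hi → complete st l (≤∧≢⇒< m<hi (≢hi l))
    ; sound    = λ k∈ → let l , m<hi = sound st k∈ in l , <⇒≤ m<hi
    ; ordered  = ordered st
    ; linked   = linked st
    }
    where
      ≢hi : ∀ {k} → Label n k → suc m ≢ hi k
      ≢hi {k} l eq with row⊎col k
      ... | inj₂ c = Col⇒¬Row c (subst Row (trans eq (hi-col c)) r)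
      ... | inj₁ r′ with proj₂ (parent-row l r′)
      ...   | inj₁ p≡           = contradiction (subst (_≤ n) (trans eq (trans (hi-row r′) p≡)) j≤n) 1+n≰n
      ...   | inj₂ (_ , cp , _) = Col⇒¬Row cp (subst Row (trans eq (hi-row r′)) r)

  module _ {m : ℕ} {u v is : List ℕ} (lj : Label n (suc m)) (c : Col (suc m))
           (st : Stage (suc m) (u ++ parent (suc m) ∷ v))
           (⊇ : ∀ {k} → Label n k → Row k → parent k ≡ suc m → k ∈ is)
           (⊆ : ∀ {k} → k ∈ is → Label n k × Row k × parent k ≡ suc m)
           (<s : AllPairs _<_ is) where

    private
      j = suc m
      i = parent j
      li = proj₁ (parent-col lj c)
      ri = proj₁ (proj₂ (parent-col lj c))
      i<j = proj₁ (proj₂ (proj₂ (parent-col lj c)))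

      j⊏i : j ⊏ i
      j⊏i = lj , li , done

      white⊏j : ∀ {x} → x ∈ is → x ⊏ j
      white⊏j x∈ = let l , _ , p≡ = ⊆ x∈ in l , subst (λ p → Label n p × p ⊑ j) (sym p≡) (lj , done)

      white⊑j : ∀ {x} → x ∈ is → x ⊑ j
      white⊑j = ⊏⇒⊑ ∘ white⊏j

      white<j : ∀ {x} → x ∈ is → x < j
      white<j x∈ = let l , r , p≡ = ⊆ x∈ in subst (_ <_) p≡ (proj₁ (parent-row l r))

      i<white : ∀ {x} → x ∈ is → i < x
      i<white {x} x∈ = let l , r , p≡ = ⊆ x∈ in
        subst (λ p → parent p < x) p≡ (proj₂ (parent-row-label l r (subst (Label n) (sym p≡) lj)))

      j<hi : ∀ {a} → a ∈ u → j < hi a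
      j<hi a∈ = proj₂ (sound st (∈-++⁺ˡ a∈))

      u≺i : ∀ {a} → a ∈ u → a ≺ i
      u≺i a∈ = All.head (All.lookup (AllPairs-++-cross u (ordered st)) a∈)

      -- A descendant of i already present lies under a column > j in row i, which is a sibling left of j.
      before : ∀ {a x} → a ∈ u → x ⊑ j → a ≺ x
      before a∈ x⊑j with u≺i a∈
      ... | branch p q s = branch p (⊑-trans (⊑-trans x⊑j (⊏⇒⊑ j⊏i)) q) s
      ... | descend p with ⊏-last p
      ...   | d , a⊑d , ld , p≡ =
        branch a⊑d x⊑j (cols cd c p≡ (<-≤-trans (j<hi a∈) (subst (_ ≤_) (hi-col cd) (hi-mono a⊑d))))
        where cd = child-of-row ld (subst (Label n) (sym p≡) li) (subst Row (sym p≡) ri)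

      i≺v : ∀ {b} → b ∈ i ∷ v → j ≺ b
      i≺v (here refl) = descend j⊏i
      i≺v (there b∈) = ⊑-≺-trans (⊏⇒⊑ j⊏i) (All.lookup (AllPairs.head (AllPairs-++ʳ u (ordered st))) b∈)

      block : AllPairs _≺_ (is ++ j ∷ i ∷ v)
      block = AllPairs.++⁺
        (sorted-siblings (λ x∈ y∈ → let _ , r , p≡ = ⊆ x∈ ; _ , r′ , p≡′ = ⊆ y∈ in rows r r′ (trans p≡ (sym p≡′))) <s)
        (All.tabulate i≺v ∷ AllPairs-++ʳ u (ordered st))
        (All.tabulate λ x∈ → descend (white⊏j x∈) ∷ All.tabulate (⊑-≺-trans (white⊑j x∈) ∘ i≺v))

      before-block : ∀ {a y} → a ∈ u → y ∈ is ++ j ∷ i ∷ v → a ≺ y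
      before-block a∈ y∈ with ∈-++⁻ is y∈
      ... | inj₁ y∈is         = before a∈ (white⊑j y∈is)
      ... | inj₂ (here refl)  = before a∈ done
      ... | inj₂ (there y∈iv) = All.lookup (All.lookup (AllPairs-++-cross u (ordered st)) a∈) y∈iv

      -- The left neighbour of `i` keeps its kind of step when `y` takes the place of `i`: a row
      -- below `i` is also below `y`, while a column already present exceeds `j` and therefore `y`.
      ⋖-left : ∀ {a y} → i < y → y ≤ j → a ∈ u → a ⋖ i → a ⋖ y
      ⋖-left i<y y≤j a∈ (inj₁ (r , a<i)) = inj₁ (r , <-trans a<i i<y)
      ⋖-left i<y y≤j a∈ (inj₂ (cl , _))  = inj₂ (cl , ≤-<-trans y≤j (subst (_ <_) (hi-col cl) (j<hi a∈)))

    stage-col : Stage m (u ++ is ++ j ∷ i ∷ v)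
    stage-col = record
      { complete = complete′
      ; sound    = sound′
      ; ordered = AllPairs.++⁺ (AllPairs-++ˡ u (ordered st)) block
                    (All.tabulate λ a∈ → All.tabulate (before-block a∈))
      ; linked   = subst (Linked _⋖_) (sym (trans (++-assoc u _ _) (cong (u ++_) (++-assoc is _ _))))
                     (insert is id (Row-linked (All.tabulate λ x∈ → proj₁ (proj₂ (⊆ x∈)) , white<j x∈) <s
                                      (inj₂ (c , i<j) ∷ Linked-++ʳ u linked-old)))
      }
      where
        -- Besides the old entries, exactly the labels with `hi k ≡ j` become due: the rows hanging
        -- from `j`, and `j` itself.
        complete′ : ∀ {k} → Label n k → m < hi k → k ∈ u ++ is ++ j ∷ i ∷ v
        complete′ {k} l m<hi with m≤n⇒m<n∨m≡n m<hi
        ... | inj₁ j<hi with ∈-++⁻ u (complete st l j<hi)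
        ...   | inj₁ k∈u  = ∈-++⁺ˡ k∈u
        ...   | inj₂ k∈iv = ∈-++⁺ʳ u (∈-++⁺ʳ is (there k∈iv))
        complete′ {k} l m<hi | inj₂ j≡hi with row⊎col k
        ...   | inj₁ r = ∈-++⁺ʳ u (∈-++⁺ˡ (⊇ l r (trans (sym (hi-row r)) (sym j≡hi))))
        ...   | inj₂ ck = ∈-++⁺ʳ u (∈-++⁺ʳ is (here (trans (sym (hi-col ck)) (sym j≡hi))))

        sound-old : ∀ {k} → k ∈ u ++ i ∷ v → Label n k × m < hi k
        sound-old k∈ = let l , j<hi = sound st k∈ in l , <⇒≤ j<hi

        sound′ : ∀ {k} → k ∈ u ++ is ++ j ∷ i ∷ v → Label n k × m < hi k
        sound′ k∈ with ∈-++⁻ u k∈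
        ... | inj₁ k∈u = sound-old (∈-++⁺ˡ k∈u)
        ... | inj₂ k∈b with ∈-++⁻ is k∈b
        ...   | inj₁ k∈is = let l , r , p≡ = ⊆ k∈is in l , ≤-reflexive (sym (trans (hi-row r) p≡))
        ...   | inj₂ (here refl)  = lj , ≤-reflexive (sym (hi-col c))
        ...   | inj₂ (there k∈iv) = sound-old (∈-++⁺ʳ u k∈iv)

        linked-old : Linked _⋖_ (u ++ i ∷ v ∷ʳ suc n)
        linked-old = subst (Linked _⋖_) (++-assoc u (i ∷ v) [ suc n ]) (linked st)

        -- The new right neighbour of `u` is `j` if no row hangs from it, and otherwise the first
        -- such row; both lie above `i` and at most at `j`.
        insert : ∀ is′ → (∀ {x} → x ∈ is′ → x ∈ is) → Linked _⋖_ (is′ ++ j ∷ i ∷ v ∷ʳ suc n) →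
                 Linked _⋖_ (u ++ is′ ++ j ∷ i ∷ v ∷ʳ suc n)
        insert []      _  = Linked-replace-tail u linked-old (⋖-left i<j ≤-refl)
        insert (x ∷ _) is′⊆ = Linked-replace-tail u linked-old
          (⋖-left (i<white (is′⊆ (here refl))) (<⇒≤ (white<j (is′⊆ (here refl)))))

-- Boolean tests, searches and insertions.

true⊎false : ∀ b → b ≡ true ⊎ b ≡ false
true⊎false true  = inj₁ refl
true⊎false false = inj₂ refl

∧-true⁻ : ∀ {x y} → x ∧ y ≡ true → x ≡ true × y ≡ true
∧-true⁻ {x} {y} e = ∧-conicalˡ x y e , ∧-conicalʳ x y e

∧-true⁺ : ∀ {x y} → x ≡ true → y ≡ true → x ∧ y ≡ true
∧-true⁺ refl refl = refl

<ᵇ-true⁻ : ∀ {m n} → (m <ᵇ n) ≡ true → m < n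
<ᵇ-true⁻ {m} {n} = <ᵇ⇒< m n ∘ Equivalence.from T-≡

<ᵇ-true⁺ : ∀ {m n} → m < n → (m <ᵇ n) ≡ true
<ᵇ-true⁺ = Equivalence.to T-≡ ∘ <⇒<ᵇ

<ᵇ-false⁺ : ∀ {m n} → ¬ m < n → (m <ᵇ n) ≡ false
<ᵇ-false⁺ ¬lt = ¬-not (¬lt ∘ <ᵇ-true⁻)

≡ᵇ-true⁻ : ∀ {m n} → (m ≡ᵇ n) ≡ true → m ≡ n
≡ᵇ-true⁻ {m} {n} = ≡ᵇ⇒≡ m n ∘ Equivalence.from T-≡

≡ᵇ-true⁺ : ∀ {m n} → m ≡ n → (m ≡ᵇ n) ≡ true
≡ᵇ-true⁺ {m} {n} = Equivalence.to T-≡ ∘ ≡⇒≡ᵇ m n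

≡ᵇ-false⁺ : ∀ {m n} → m ≢ n → (m ≡ᵇ n) ≡ false
≡ᵇ-false⁺ m≢n = ¬-not (m≢n ∘ ≡ᵇ-true⁻)

module _ {p : ℕ → Bool} where

  anyB⁺ : ∀ {x xs} → x ∈ xs → p x ≡ true → anyB p xs ≡ true
  anyB⁺ (here refl) px rewrite px = refl
  anyB⁺ {xs = y ∷ _} (there x∈) px with p y
  ... | true  = refl
  ... | false = anyB⁺ x∈ px

  firstB-satisfies : ∀ xs → anyB p xs ≡ true → firstB p xs ∈ xs × p (firstB p xs) ≡ true
  firstB-satisfies (x ∷ xs) e with p x in px
  ... | true  = here refl , px
  ... | false = let f∈ , pf = firstB-satisfies xs e in there f∈ , pf

  firstB-minimal : ∀ {x xs} → AllPairs _<_ xs → x ∈ xs → p x ≡ true → firstB p xs ≤ x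
  firstB-minimal {xs = y ∷ _} (<s ∷ _) x∈ px with p y in py | x∈
  ... | true  | here refl = ≤-refl
  ... | true  | there x∈′ = <⇒≤ (All.lookup <s x∈′)
  ... | false | here refl with () ← trans (sym px) py
  firstB-minimal (_ ∷ <<s) _ px | false | there x∈′ = firstB-minimal <<s x∈′ px

  anyB⁻ : ∀ {xs} → anyB p xs ≡ true → ∃[ x ] x ∈ xs × p x ≡ true
  anyB⁻ {xs} e = firstB p xs , firstB-satisfies xs e

insertBefore-++ : ∀ {x y} u {v} → y ∉ u → insertBefore x y (u ++ y ∷ v) ≡ u ++ x ∷ y ∷ v
insertBefore-++ {y = y} []      _  rewrite ≡ᵇ-true⁺ {y} refl = refl
insertBefore-++ (a ∷ u) y∉ rewrite ≡ᵇ-false⁺ (y∉ ∘ here ∘ sym) = cong (a ∷_) (insertBefore-++ u (y∉ ∘ there))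

insertAllBefore : ℕ → List ℕ → List ℕ → List ℕ
insertAllBefore j []       w = w
insertAllBefore j (i ∷ is) w = insertAllBefore j is (insertBefore i j w)

-- Each label lands between its predecessors and `j`, which preserves the order of `is`. As `j`
-- occurs neither in `is` nor in `u`, every search stops at the same `j`.
insertAllBefore-++ : ∀ {j} is u {v} → j ∉ is → j ∉ u → insertAllBefore j is (u ++ j ∷ v) ≡ u ++ is ++ j ∷ v
insertAllBefore-++ []       u _   _   = refl
insertAllBefore-++ {j} (i ∷ is) u {v} j∉is j∉u = begin
  insertAllBefore j is (insertBefore i j (u ++ j ∷ v))  ≡⟨ cong (insertAllBefore j is) (insertBefore-++ u j∉u) ⟩
  insertAllBefore j is (u ++ i ∷ j ∷ v)                 ≡⟨ cong (insertAllBefore j is) (++-assoc u [ i ] (j ∷ v)) ⟨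
  insertAllBefore j is (u ∷ʳ i ++ j ∷ v)                ≡⟨ insertAllBefore-++ is (u ∷ʳ i) (j∉is ∘ there) j∉u∷ʳi ⟩
  u ∷ʳ i ++ is ++ j ∷ v                                 ≡⟨ ++-assoc u [ i ] _ ⟩
  u ++ i ∷ is ++ j ∷ v                                  ∎
  where
    open ≡-Reasoning
    j∉u∷ʳi : j ∉ u ∷ʳ i
    j∉u∷ʳi j∈ with ∈-++⁻ u j∈
    ... | inj₁ j∈u         = j∉u j∈u
    ... | inj₂ (here j≡i) = j∉is (here j≡i)

-- The tree of a permutation tableau.

module Tableau {n} (T : PermTableau n) where
  open PermTableau T using (IsCell; fill; columnHasOne; noBadZero) renaming (isRow to isRow₀)

  -- On an unrestricted row `whiteCol` would return the default 0; the virtual column replaces it.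
  parent₀ : ℕ → ℕ
  parent₀ k = if isRow₀ k then (if unrestrictedRow T k then suc n else whiteCol T k) else blackRow T k

  parent-blackRow : ∀ {k} → isRow₀ k ≡ false → parent₀ k ≡ blackRow T k
  parent-blackRow {k} c = cong (if_then (if unrestrictedRow T k then suc n else whiteCol T k) else blackRow T k) c

  parent-suc-n : ∀ {k} → isRow₀ k ≡ true → unrestrictedRow T k ≡ true → parent₀ k ≡ suc n
  parent-suc-n {k} r u =
    trans (cong (if_then (if unrestrictedRow T k then suc n else whiteCol T k) else blackRow T k) r)
          (cong (if_then suc n else whiteCol T k) u)

  parent-whiteCol : ∀ {k} → isRow₀ k ≡ true → unrestrictedRow T k ≡ false → parent₀ k ≡ whiteCol T k
  parent-whiteCol {k} r u =
    trans (cong (if_then (if unrestrictedRow T k then suc n else whiteCol T k) else blackRow T k) r)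
          (cong (if_then suc n else whiteCol T k) u)

  cell⁻ : ∀ {i j} → Label n i → Label n j → isCellB T i j ≡ true → IsCell i j
  cell⁻ (1≤i , _) (_ , j≤n) e =
    let r , e′ = ∧-true⁻ e ; c , i<j = ∧-true⁻ e′ in 1≤i , <ᵇ-true⁻ i<j , j≤n , r , not-injective c

  one⁻ : ∀ {i j} → Label n i → Label n j → oneAt T i j ≡ true → IsCell i j × fill i j ≡ true
  one⁻ li lj e = let c , f = ∧-true⁻ e in cell⁻ li lj c , f

  one⁺ : ∀ {i j} → IsCell i j → fill i j ≡ true → oneAt T i j ≡ true
  one⁺ (_ , i<j , _ , r , c) f = ∧-true⁺ (∧-true⁺ r (∧-true⁺ (cong not c) (<ᵇ-true⁺ i<j))) f

  -- `columnHasOne` guarantees that the search behind `blackRow` succeeds and does not return its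
  -- default 0.
  black : ∀ {j} → Label n j → isRow₀ j ≡ false →
          Label n (blackRow T j) × IsCell (blackRow T j) j × fill (blackRow T j) j ≡ true
  black {j} lj@(1≤j , j≤n) c =
    let i , cell@(1≤i , i<j , _) , f = columnHasOne j 1≤j j≤n c
        b∈ , one = firstB-satisfies (labels n)
                     (anyB⁺ {λ i → oneAt T i j} (∈-labels⁺ (1≤i , ≤-trans (<⇒≤ i<j) j≤n)) (one⁺ cell f))
    in ∈-labels⁻ b∈ , one⁻ (∈-labels⁻ b∈) lj one

  white : ∀ {i} → Label n i → unrestrictedRow T i ≡ false → let j = whiteCol T i in
          Label n j × IsCell i j × fill i j ≡ false ×
          ∃[ i′ ] Label n i′ × i′ < i × IsCell i′ j × fill i′ j ≡ true
  white {i} li e =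
    let j∈ , z       = firstB-satisfies {λ j → restrictedZero T i j} (labels n) (not-injective e)
        lj           = ∈-labels⁻ j∈
        c , z′       = ∧-true⁻ z
        f , a        = ∧-true⁻ z′
        i′ , i′∈ , o = anyB⁻ {xs = labels n} a
        i′<i , o′    = ∧-true⁻ o
        li′          = ∈-labels⁻ i′∈
    in lj , cell⁻ li lj c , not-injective f , i′ , li′ , <ᵇ-true⁻ i′<i , one⁻ li′ lj o′

  tree : AlternatingTree n
  tree = record
    { isRow      = isRow₀
    ; parent     = parent₀
    ; parent-col = parent-col
    ; parent-row = parent-row
    }
    where
      -- A white dot in the row of the black dot of `j` must lie to the left of column `j`. If it
      -- were to the right, this restricted zero would have a 1 above it and the black dot to its
      -- left, against `noBadZero`; in column `j` itself the entry is 1.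
      below-black : ∀ {j} → Label n j → isRow₀ j ≡ false → j < parent₀ (blackRow T j)
      below-black {j} lj c with black lj c
      ... | li , cell@(_ , _ , _ , r , _) , one with true⊎false (unrestrictedRow T (blackRow T j))
      ...   | inj₁ e = subst (j <_) (sym (parent-suc-n r e)) (s≤s (proj₂ lj))
      ...   | inj₂ e with white li e
      ...     | _ , cell₀ , zero₀ , i′ , _ , i′<i , cell′ , one′ with <-cmp j (whiteCol T (blackRow T j))
      ...       | tri< lt _ _ = subst (j <_) (sym (parent-whiteCol r e)) lt
      ...       | tri≈ _ j≡ _ with () ← trans (sym one) (trans (cong (fill _) j≡) zero₀)
      ...       | tri> _ _ gt = ⊥-elim (noBadZero _ _ i′ j cell₀ zero₀ cell′ i′<i one′ cell gt one)

      parent-col : ∀ {j} → Label n j → isRow₀ j ≡ false →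
                   Label n (parent₀ j) × isRow₀ (parent₀ j) ≡ true × parent₀ j < j × j < parent₀ (parent₀ j)
      parent-col {j} lj c =
        let li , (_ , i<j , _ , r , _) , _ = black lj c in
        subst (λ i → Label n i × isRow₀ i ≡ true × i < j × j < parent₀ i) (sym (parent-blackRow c))
          (li , r , i<j , below-black lj c)

      parent-row : ∀ {i} → Label n i → isRow₀ i ≡ true → i < parent₀ i ×
                   (parent₀ i ≡ suc n ⊎ Label n (parent₀ i) × isRow₀ (parent₀ i) ≡ false × parent₀ (parent₀ i) < i)
      parent-row {i} li r with true⊎false (unrestrictedRow T i)
      ... | inj₁ e = let p≡ = parent-suc-n r e in
                    subst (i <_) (sym p≡) (s≤s (proj₂ li)) , inj₁ p≡
      ... | inj₂ e =
        let lj , (_ , i<j , _ , _ , c) , _ , i′ , li′ , i′<i , cell′ , one′ = white li e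
            -- The black dot is the topmost 1, so it is no lower than the 1 that restricts the zero
            -- and lies strictly above row `i`.
            b≤i′ = firstB-minimal {λ h → oneAt T h (whiteCol T i)} (labels-sorted n) (∈-labels⁺ li′)
                     (one⁺ {i′} {whiteCol T i} cell′ one′)
        in subst (λ j → i < j × (j ≡ suc n ⊎ Label n j × isRow₀ j ≡ false × parent₀ j < i))
             (sym (parent-whiteCol r e))
             (i<j , inj₂ (lj , c , subst (_< i) (sym (parent-blackRow c)) (≤-<-trans b≤i′ i′<i)))

  open Postorder tree public

  -- The insertion procedure builds the postorder.

  whiteRows : ℕ → List ℕ
  whiteRows j = filterB (λ i → isRow i ∧ not (unrestrictedRow T i) ∧ (whiteCol T i ≡ᵇ j)) (labels n)

  -- The insertion loop of ξStep is local to its definition, so it is named here by unification.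
  mutual
    insertWhites≗insertAllBefore : (w : List ℕ) (j : ℕ) (is v : List ℕ) → _ ≡ insertAllBefore j is v

    ξStep≡ : (w : List ℕ) (j : ℕ) → ξStep T w j ≡ insertAllBefore j (whiteRows j) (insertBefore j (blackRow T j) w)
    ξStep≡ w j with whiteRows j | insertBefore j (blackRow T j) w
    ... | is | v = insertWhites≗insertAllBefore w j is v

    insertWhites≗insertAllBefore w j []       v = refl
    insertWhites≗insertAllBefore w j (i ∷ is) v = insertWhites≗insertAllBefore w j is (insertBefore i j v)

  unrestricted⁺ : ∀ {k} → Label n k → Row k → parent k ≡ suc n → unrestrictedRow T k ≡ true
  unrestricted⁺ {k} l r p≡ with true⊎false (unrestrictedRow T k)
  ... | inj₁ u = u
  ... | inj₂ u = contradiction (subst (_≤ n) (trans (sym (parent-whiteCol r u)) p≡) (proj₂ (proj₁ (white l u)))) 1+n≰n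

  ∈-roots⁺ : ∀ {k} → Label n k → Row k → parent k ≡ suc n → k ∈ filterB (λ i → isRow i ∧ unrestrictedRow T i) (labels n)
  ∈-roots⁺ l r p≡ = ∈-filterB⁺ (∈-labels⁺ l) (∧-true⁺ r (unrestricted⁺ l r p≡))

  ∈-roots⁻ : ∀ {k} → k ∈ filterB (λ i → isRow i ∧ unrestrictedRow T i) (labels n) → Label n k × Row k × parent k ≡ suc n
  ∈-roots⁻ k∈ = let k∈′ , e = ∈-filterB⁻ {xs = labels n} k∈ ; r , u = ∧-true⁻ e in
                ∈-labels⁻ k∈′ , r , parent-suc-n r u

  ∈-whiteRows⁺ : ∀ {j k} → Label n j → Label n k → Row k → parent k ≡ j → k ∈ whiteRows j
  ∈-whiteRows⁺ {j} {k} lj l r p≡ = ∈-filterB⁺ (∈-labels⁺ l) (∧-true⁺ r restricted)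
    where
      restricted : not (unrestrictedRow T k) ∧ (whiteCol T k ≡ᵇ j) ≡ true
      restricted with true⊎false (unrestrictedRow T k)
      ... | inj₁ u = contradiction (subst (_≤ n) (trans (sym p≡) (parent-suc-n r u)) (proj₂ lj)) 1+n≰n
      ... | inj₂ u = ∧-true⁺ (cong not u) (≡ᵇ-true⁺ (trans (sym (parent-whiteCol r u)) p≡))

  ∈-whiteRows⁻ : ∀ {j k} → k ∈ whiteRows j → Label n k × Row k × parent k ≡ j
  ∈-whiteRows⁻ k∈ =
    let k∈′ , e = ∈-filterB⁻ {xs = labels n} k∈ ; r , e′ = ∧-true⁻ e ; u , w = ∧-true⁻ e′ in
    ∈-labels⁻ k∈′ , r , trans (parent-whiteCol r (not-injective u)) (≡ᵇ-true⁻ w)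

  ξStep-++ : ∀ {j} u v → Label n j → Col j → j ∉ u → parent j ∉ u →
             ξStep T (u ++ parent j ∷ v) j ≡ u ++ whiteRows j ++ j ∷ parent j ∷ v
  ξStep-++ {j} u v lj c j∉u i∉u = begin
    ξStep T (u ++ parent j ∷ v) j
      ≡⟨ ξStep≡ (u ++ parent j ∷ v) j ⟩
    insertAllBefore j (whiteRows j) (insertBefore j (blackRow T j) (u ++ parent j ∷ v))
      ≡⟨ cong (λ i → insertAllBefore j (whiteRows j) (insertBefore j i (u ++ parent j ∷ v))) (parent-blackRow c) ⟨
    insertAllBefore j (whiteRows j) (insertBefore j (parent j) (u ++ parent j ∷ v))
      ≡⟨ cong (insertAllBefore j (whiteRows j)) (insertBefore-++ u i∉u) ⟩
    insertAllBefore j (whiteRows j) (u ++ j ∷ parent j ∷ v)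
      ≡⟨ insertAllBefore-++ (whiteRows j) u j∉is j∉u ⟩
    u ++ whiteRows j ++ j ∷ parent j ∷ v
      ∎
    where
      open ≡-Reasoning
      j∉is : j ∉ whiteRows j
      j∉is j∈ = Col⇒¬Row c (proj₁ (proj₂ (∈-whiteRows⁻ {j} j∈)))

  stage-ξStep : ∀ {m w} → Label n (suc m) → Col (suc m) → Stage (suc m) w → Stage m (ξStep T w (suc m))
  -- The row of the black dot entered the word earlier, because its own parent is a column beyond
  -- `suc m`.
  stage-ξStep {m} lj c st with ∈-∃++ (complete st li (subst (suc m <_) (sym (hi-row r)) j<pp))
    where
      li = proj₁ (parent-col lj c)
      r = proj₁ (proj₂ (parent-col lj c))
      j<pp = proj₂ (proj₂ (proj₂ (parent-col lj c)))
  ... | u , v , refl = subst (Stage m) (sym (ξStep-++ u v lj c j∉u i∉u))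
                         (stage-col lj c st (∈-whiteRows⁺ lj) ∈-whiteRows⁻
                           (filterB-AllPairs _ (labels-sorted n)))
    where
      j∉u : suc m ∉ u
      j∉u j∈ = <-irrefl (sym (hi-col c)) (proj₂ (sound st (∈-++⁺ˡ j∈)))

      -- An occurrence of this row in `u` would precede the displayed one, hence itself.
      i∉u : parent (suc m) ∉ u
      i∉u i∈ = ≺-irrefl (All.head (All.lookup (AllPairs-++-cross u (ordered st)) i∈))

  stage-foldl : ∀ {m w} → m ≤ n → Stage m w →
                Stage 0 (foldl (ξStep T) w (filterB (λ j → not (isRow j)) (reverse (labels m))))
  stage-foldl {zero}      _   st = st
  stage-foldl {suc m} {w} m<n st rewrite reverse-labels m with isRow (suc m) in e
  ... | true  = stage-foldl (<⇒≤ m<n) (stage-row (s≤s z≤n , m<n) e st)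
  ... | false = stage-foldl (<⇒≤ m<n) (stage-ξStep (s≤s z≤n , m<n) e st)

  stage-ξ : Stage 0 (ξ T)
  stage-ξ = stage-foldl ≤-refl (stage-init ∈-roots⁺ ∈-roots⁻ (filterB-AllPairs _ (labels-sorted n)))

-- Alternating paths as ancestor chains.

elemB⁺ : ∀ {x xs} → x ∈ xs → elemB x xs ≡ true
elemB⁺ {x} x∈ = anyB⁺ x∈ (≡ᵇ-true⁺ {x} refl)

elemB⁻ : ∀ {x xs} → elemB x xs ≡ true → x ∈ xs
elemB⁻ {x} {xs} e with anyB⁻ {xs = xs} e
... | y , y∈ , x≡y = subst (_∈ xs) (sym (≡ᵇ-true⁻ {x} x≡y)) y∈

elemB-false : ∀ {x xs} → x ∉ xs → elemB x xs ≡ false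
elemB-false x∉ = ¬-not (x∉ ∘ elemB⁻)

eqListB-sound : ∀ xs ys → eqListB xs ys ≡ true → xs ≡ ys
eqListB-sound []       []       _ = refl
eqListB-sound (x ∷ xs) (y ∷ ys) e = let x≡y , xs≡ys = ∧-true⁻ e in cong₂ _∷_ (≡ᵇ-true⁻ x≡y) (eqListB-sound xs ys xs≡ys)

takeWhileB-++ : ∀ {p xs y ys} → (∀ {x} → x ∈ xs → p x ≡ true) → p y ≡ false → takeWhileB p (xs ++ y ∷ ys) ≡ xs
takeWhileB-++ {xs = []}     _  py rewrite py = refl
takeWhileB-++ {xs = x ∷ xs} ps py rewrite ps (here refl) = cong (x ∷_) (takeWhileB-++ (ps ∘ there) py)

lastOr0-∷ʳ : ∀ xs {x} → lastOr0 (xs ∷ʳ x) ≡ x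
lastOr0-∷ʳ []           = refl
lastOr0-∷ʳ (_ ∷ [])     = refl
lastOr0-∷ʳ (_ ∷ y ∷ xs) = lastOr0-∷ʳ (y ∷ xs)

module Paths {n} (T : PermTableau n) where
  open Tableau T

  containsB⇒∈ : ∀ P {k Q} → containsB T P (k ∷ Q) ≡ true → k ∈ P
  containsB⇒∈ P {k} {Q} e =
    let m = length P ∸ length (k ∷ Q)
        drop≡ = eqListB-sound (drop m P) (k ∷ Q) (proj₂ (∧-true⁻ e))
    in subst (k ∈_) (take++drop≡id m P) (∈-++⁺ʳ (take m P) (subst (k ∈_) (sym drop≡) (here refl)))

  greaterB-disjoint : ∀ {P Q} → (∀ {z} → z ∈ P → z ∉ Q) →
    let (r , c) = dotPos T (lastOr0 P) ; (r′ , c′) = dotPos T (lastOr0 Q) in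
    greaterB T P Q ≡ (r′ <ᵇ r) ∨ ((r ≡ᵇ r′) ∧ (c <ᵇ c′))
  greaterB-disjoint {P} {Q} P∥Q with anyB (λ x → elemB x Q) P in e
  ... | false = refl
  ... | true  = let _ , z∈P , z∈Q = anyB⁻ {xs = P} e in contradiction (elemB⁻ z∈Q) (P∥Q z∈P)

  -- Here `d` is the first common dot and `x`, `y` are the dots just before it. Both calls of
  -- `takeWhileB` stop at `d`, so the truncated paths end at `x` and `y`.
  greaterB-meet : ∀ A B {x y d R} →
    (∀ {z} → z ∈ A ∷ʳ x → z ∉ (B ∷ʳ y) ++ d ∷ R) →
    (∀ {z} → z ∈ B ∷ʳ y → z ∉ (A ∷ʳ x) ++ d ∷ R) →
    let (r , c) = dotPos T x ; (r′ , c′) = dotPos T y in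
    greaterB T ((A ∷ʳ x) ++ d ∷ R) ((B ∷ʳ y) ++ d ∷ R) ≡ (r′ <ᵇ r) ∨ (c <ᵇ c′)
  greaterB-meet A B {x} {y} {d} {R} A∥ B∥ with anyB (λ z → elemB z ((B ∷ʳ y) ++ d ∷ R)) ((A ∷ʳ x) ++ d ∷ R) in e
  ... | false with () ← trans (sym e) (anyB⁺ (∈-++⁺ʳ (A ∷ʳ x) (here refl)) (elemB⁺ (∈-++⁺ʳ (B ∷ʳ y) (here refl))))
  ... | true
    rewrite takeWhileB-++ {λ z → not (elemB z ((B ∷ʳ y) ++ d ∷ R))} {A ∷ʳ x} {d} {R}
              (cong not ∘ elemB-false ∘ A∥) (cong not (elemB⁺ (∈-++⁺ʳ (B ∷ʳ y) (here refl))))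
          | takeWhileB-++ {λ z → not (elemB z ((A ∷ʳ x) ++ d ∷ R))} {B ∷ʳ y} {d} {R}
              (cong not ∘ elemB-false ∘ B∥) (cong not (elemB⁺ (∈-++⁺ʳ (A ∷ʳ x) (here refl))))
          | lastOr0-∷ʳ A {x} | lastOr0-∷ʳ B {y} = refl

  -- `Label n (parent k)` serves as the condition that `k` labels a dot: a parent leaves the range
  -- only for an unrestricted row.
  root⊎inner : ∀ {k} → Label n k → (Row k × parent k ≡ suc n) ⊎ Label n (parent k)
  root⊎inner {k} l with row⊎col k
  ... | inj₂ c = inj₂ (proj₁ (parent-col l c))
  ... | inj₁ r with proj₂ (parent-row l r)
  ...   | inj₁ p≡       = inj₁ (r , p≡)
  ...   | inj₂ (lp , _) = inj₂ lp

  root-not-inner : ∀ {k} → parent k ≡ suc n → ¬ Label n (parent k)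
  root-not-inner p≡ lp = contradiction (subst (_≤ n) p≡ (proj₂ lp)) 1+n≰n

  restricted : ∀ {k} → Row k → Label n (parent k) → unrestrictedRow T k ≡ false
  restricted r lp = ¬-not λ u → root-not-inner (parent-suc-n r u) lp

  dotPos-row : ∀ {k} → Row k → Label n (parent k) → dotPos T k ≡ (k , parent k)
  dotPos-row {k} r lp = trans (cong (if_then (k , whiteCol T k) else (blackRow T k , k)) r)
                              (cong (k ,_) (sym (parent-whiteCol r (restricted r lp))))

  dotPos-col : ∀ {k} → Col k → dotPos T k ≡ (parent k , k)
  dotPos-col {k} c = trans (cong (if_then (k , whiteCol T k) else (blackRow T k , k)) c)
                           (cong (_, k) (sym (parent-blackRow c)))

  isDotLabel⁺ : ∀ {k} → Label n k → Label n (parent k) → isDotLabel T k ≡ true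
  isDotLabel⁺ {k} l lp with row⊎col k
  ... | inj₁ r = trans (cong (λ b → not b ∨ not (unrestrictedRow T k)) r) (cong not (restricted r lp))
  ... | inj₂ c = cong (λ b → not b ∨ not (unrestrictedRow T k)) c

  isDotLabel⁻ : ∀ {k} → Label n k → isDotLabel T k ≡ true → Label n (parent k)
  isDotLabel⁻ {k} l e with root⊎inner l
  ... | inj₂ lp = lp
  ... | inj₁ (r , p≡) with () ← trans (sym e) (trans (cong (λ b → not b ∨ not (unrestrictedRow T k)) r)
                                                     (cong not (unrestricted⁺ l r p≡)))

  nextDot-row : ∀ {k} → Row k → nextDot T k ≡ just (whiteCol T k)
  nextDot-row {k} r =
    cong (if_then just (whiteCol T k) else (if unrestrictedRow T (blackRow T k) then nothing else just (blackRow T k))) r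

  nextDot-col : ∀ {k} → Col k → nextDot T k ≡ (if unrestrictedRow T (parent k) then nothing else just (parent k))
  nextDot-col {k} c = subst (λ i → nextDot T k ≡ (if unrestrictedRow T i then nothing else just i)) (sym (parent-blackRow c))
    (cong (if_then just (whiteCol T k) else (if unrestrictedRow T (blackRow T k) then nothing else just (blackRow T k))) c)

  nextDot-inner : ∀ {k} → Label n k → Label n (parent k) → Label n (parent (parent k)) → nextDot T k ≡ just (parent k)
  nextDot-inner {k} l lp lpp with row⊎col k
  ... | inj₁ r = trans (nextDot-row r) (cong just (sym (parent-whiteCol r (restricted r lp))))
  ... | inj₂ c = trans (nextDot-col c)
    (cong (if_then nothing else just (parent k)) (restricted (proj₁ (proj₂ (parent-col l c))) lpp))

  nextDot-last : ∀ {k} → Label n k → Label n (parent k) → parent (parent k) ≡ suc n → nextDot T k ≡ nothing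
  nextDot-last {k} l lp pp≡ with row⊎col k
  ... | inj₁ r = contradiction (proj₁ (parent-col lp (proj₁ (parent-row-label l r lp)))) (root-not-inner pp≡)
  ... | inj₂ c = trans (nextDot-col c)
    (cong (if_then nothing else just (parent k)) (unrestricted⁺ lp (proj₁ (proj₂ (parent-col l c))) pp≡))

  pathFuel-inner : ∀ f {k} → Label n k → Label n (parent k) → Label n (parent (parent k)) →
                   pathFuel T (suc f) k ≡ k ∷ pathFuel T f (parent k)
  pathFuel-inner f l lp lpp rewrite nextDot-inner l lp lpp = refl

  pathFuel-last : ∀ f {k} → Label n k → Label n (parent k) → parent (parent k) ≡ suc n → pathFuel T (suc f) k ≡ k ∷ []
  pathFuel-last f l lp pp≡ rewrite nextDot-last l lp pp≡ = refl

  -- A step costs one unit of fuel but widens the interval by at least one, so fuel plus width stays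
  -- at least `n`. Since a dot has width below `n`, the fuel is never empty before the path ends.
  pathFuel-stable : ∀ f g {k} → Label n k → Label n (parent k) → n ≤ f + width k → n ≤ g + width k →
                    pathFuel T f k ≡ pathFuel T g k
  pathFuel-stable zero    _       l lp n≤f _   = contradiction n≤f (<⇒≱ (width<n l lp))
  pathFuel-stable (suc _) zero    l lp _   n≤g = contradiction n≤g (<⇒≱ (width<n l lp))
  pathFuel-stable (suc f) (suc g) {k} l lp n≤f n≤g with root⊎inner lp
  ... | inj₁ (_ , pp≡) = trans (pathFuel-last f l lp pp≡) (sym (pathFuel-last g l lp pp≡))
  ... | inj₂ lpp = trans (pathFuel-inner f l lp lpp)
                     (trans (cong (k ∷_) (pathFuel-stable f g lp lpp (widen f n≤f) (widen g n≤g)))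
                            (sym (pathFuel-inner g l lp lpp)))
    where
      widen : ∀ h → n ≤ suc h + width k → n ≤ h + width (parent k)
      widen h n≤ = ≤-trans n≤ (subst (_≤ h + width (parent k)) (+-suc h (width k)) (+-monoʳ-≤ h (width-parent l lp)))

  path-inner : ∀ {k} → Label n k → Label n (parent k) → Label n (parent (parent k)) → path T k ≡ k ∷ path T (parent k)
  path-inner {k} l lp lpp =
    trans (pathFuel-inner n l lp lpp)
          -- After one step `n` units remain, whereas a fresh path starts with `suc n`; both are
          -- enough.
          (cong (k ∷_) (pathFuel-stable n (suc n) lp lpp (m≤m+n n _) (m≤n⇒m≤1+n (m≤m+n n _))))

  path-last : ∀ {k} → Label n k → Label n (parent k) → parent (parent k) ≡ suc n → path T k ≡ k ∷ []
  path-last = pathFuel-last n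

  path-head : ∀ {k} → Label n k → Label n (parent k) → ∃[ R ] path T k ≡ k ∷ R
  path-head l lp with root⊎inner lp
  ... | inj₁ (_ , pp≡) = _ , path-last l lp pp≡
  ... | inj₂ lpp       = _ , path-inner l lp lpp

  pathFuel⇒⊑ : ∀ f {k z} → Label n k → Label n (parent k) → z ∈ pathFuel T f k → k ⊑ z
  pathFuel⇒⊑ (suc f) {k} {z} l lp z∈ with root⊎inner lp
  ... | inj₁ (_ , pp≡) with subst (z ∈_) (pathFuel-last f l lp pp≡) z∈
  ...   | here refl = done
  pathFuel⇒⊑ (suc f) {k} {z} l lp z∈ | inj₂ lpp with subst (z ∈_) (pathFuel-inner f l lp lpp) z∈
  ...   | here refl = done
  ...   | there z∈′ = up l lp (pathFuel⇒⊑ f lp lpp z∈′)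

  ∈-path⁻ : ∀ {k z} → Label n k → Label n (parent k) → z ∈ path T k → k ⊑ z
  ∈-path⁻ = pathFuel⇒⊑ (suc n)

  -- The endpoint is left out, so a trail can be continued by the path of `x`. When `x` is an
  -- unrestricted row and thus no dot, the trail is already the whole path.
  trail : ∀ {a x} → a ⊑ x → List ℕ
  trail done             = []
  trail (up {a} _ _ p) = a ∷ trail p

  trail-⊑ : ∀ {a x z} (p : a ⊑ x) → z ∈ trail p → z ⊑ x
  trail-⊑ p@(up _ _ _)  (here refl) = p
  trail-⊑ (up _ _ p) (there z∈)  = trail-⊑ p z∈

  ⊑-parent-label : ∀ {a x} → a ⊑ x → Label n (parent x) → Label n (parent a)
  ⊑-parent-label done        lp = lp
  ⊑-parent-label (up _ lp _) _  = lp

  path-trail : ∀ {a x} (p : a ⊑ x) → Label n (parent x) → path T a ≡ trail p ++ path T x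
  path-trail done        _  = refl
  path-trail (up {a} l lp p) lx = trans (path-inner l lp (⊑-parent-label p lx)) (cong (a ∷_) (path-trail p lx))

  ∈-path⁺ : ∀ {a x} → a ⊑ x → Label n x → Label n (parent x) → x ∈ path T a
  ∈-path⁺ {a} {x} p l lp =
    subst (x ∈_) (sym (path-trail p lp)) (∈-++⁺ʳ (trail p) (subst (x ∈_) (sym (proj₂ (path-head l lp))) (here refl)))

  path-trail-root : ∀ {a x} → Label n a → Label n (parent a) → (p : a ⊑ x) → parent x ≡ suc n → path T a ≡ trail p
  path-trail-root l lp done       p≡ = contradiction lp (root-not-inner p≡)
  path-trail-root l lp (up _ _ p) p≡ = go l lp p p≡
    where
      go : ∀ {a x} → Label n a → Label n (parent a) → (p : parent a ⊑ x) → parent x ≡ suc n → path T a ≡ a ∷ trail p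
      go     l lp done         p≡ = path-last l lp p≡
      go {a} l lp (up _ lpp p) p≡ = trans (path-inner l lp lpp) (cong (a ∷_) (go lp lpp p p≡))

  -- The dot `d` is where a path ends in the unrestricted row `x`; its row decides the comparison of
  -- paths with different final rows.
  trail-last : ∀ {a x} → Label n (parent a) → (p : a ⊑ x) → parent x ≡ suc n →
               ∃₂ λ A d → trail p ≡ A ∷ʳ d × Label n d × parent d ≡ x
  trail-last lp done       p≡ = contradiction lp (root-not-inner p≡)
  trail-last _  (up l _ p) _  = go l p
    where
      go : ∀ {a x} → Label n a → (p : parent a ⊑ x) → ∃₂ λ A d → a ∷ trail p ≡ A ∷ʳ d × Label n d × parent d ≡ x
      go {a} l done       = [] , a , refl , l , refl
      go {a} l (up lp _ p) = let A , d , t≡ , ld , pd = go lp p in a ∷ A , d , cong (a ∷_) t≡ , ld , pd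

  -- Paths that branch at siblings, and inversions.

  ≡ᵇ-refl : ∀ m → (m ≡ᵇ m) ≡ true
  ≡ᵇ-refl m = ≡ᵇ-true⁺ {m} refl

  path-top : ∀ {a x} (p : a ⊑ x) → Label n x → Label n (parent x) →
             (parent (parent x) ≡ suc n → path T a ≡ trail p ∷ʳ x) ×
             (Label n (parent (parent x)) → path T a ≡ (trail p ∷ʳ x) ++ path T (parent x))
  path-top {a} {x} p l lp =
    (λ pp≡ → trans (path-trail p lp) (cong (trail p ++_) (path-last l lp pp≡))) ,
    (λ lpp → trans (path-trail p lp)
      (trans (cong (trail p ++_) (path-inner l lp lpp)) (sym (++-assoc (trail p) [ x ] _))))

  trail∷ʳ-⊑ : ∀ {a x z} (p : a ⊑ x) → z ∈ trail p ∷ʳ x → z ⊑ x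
  trail∷ʳ-⊑ p z∈ with ∈-++⁻ (trail p) z∈
  ... | inj₁ z∈t         = trail-⊑ p z∈t
  ... | inj₂ (here refl) = done

  -- Both directions are recorded: the negative one refutes an inversion, the positive one produces
  -- it.
  Below : List ℕ → List ℕ → Set
  Below P Q = greaterB T P Q ≡ false × greaterB T Q P ≡ true

  below-disjoint : ∀ {A B x y r c r′ c′} → (∀ {z} → z ∈ A ∷ʳ x → z ∉ B ∷ʳ y) →
                   dotPos T x ≡ (r , c) → dotPos T y ≡ (r′ , c′) → r < r′ ⊎ r ≡ r′ × c′ < c →
                   Below (A ∷ʳ x) (B ∷ʳ y)
  below-disjoint {A} {B} {x} {y} {r} {c} {r′} {c′} A∥B x≡ y≡ left = PQ left , QP left
    where
      eval : ∀ A B {x y r c r′ c′} → (∀ {z} → z ∈ A ∷ʳ x → z ∉ B ∷ʳ y) →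
             dotPos T x ≡ (r , c) → dotPos T y ≡ (r′ , c′) →
             greaterB T (A ∷ʳ x) (B ∷ʳ y) ≡ (r′ <ᵇ r) ∨ ((r ≡ᵇ r′) ∧ (c <ᵇ c′))
      eval A B {x} {y} A∥B x≡ y≡ = trans (greaterB-disjoint A∥B)
        (cong₂ (λ (r , c) (r′ , c′) → (r′ <ᵇ r) ∨ ((r ≡ᵇ r′) ∧ (c <ᵇ c′)))
          (trans (cong (dotPos T) (lastOr0-∷ʳ A)) x≡) (trans (cong (dotPos T) (lastOr0-∷ʳ B)) y≡))

      PQ : r < r′ ⊎ r ≡ r′ × c′ < c → greaterB T (A ∷ʳ x) (B ∷ʳ y) ≡ false
      PQ left rewrite eval A B A∥B x≡ y≡ with left
      ... | inj₁ r<r′ rewrite <ᵇ-false⁺ (<⇒≯ r<r′) | ≡ᵇ-false⁺ (<⇒≢ r<r′) = refl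
      ... | inj₂ (refl , c′<c) rewrite <ᵇ-false⁺ (n≮n r) | ≡ᵇ-refl r | <ᵇ-false⁺ (<⇒≯ c′<c) = refl

      QP : r < r′ ⊎ r ≡ r′ × c′ < c → greaterB T (B ∷ʳ y) (A ∷ʳ x) ≡ true
      QP left rewrite eval B A (λ z∈B z∈A → A∥B z∈A z∈B) y≡ x≡ with left
      ... | inj₁ r<r′ rewrite <ᵇ-true⁺ r<r′ = refl
      ... | inj₂ (refl , c′<c) rewrite <ᵇ-false⁺ (n≮n r) | ≡ᵇ-refl r | <ᵇ-true⁺ c′<c = refl

  -- The order on meeting paths is a plain disjunction without a test for ties. Since the two dots
  -- share a row or a column, one disjunct is always false, and the other one decides.
  below-meet : ∀ {A B x y d R r c r′ c′} →
               (∀ {z} → z ∈ A ∷ʳ x → z ∉ (B ∷ʳ y) ++ d ∷ R) →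
               (∀ {z} → z ∈ B ∷ʳ y → z ∉ (A ∷ʳ x) ++ d ∷ R) →
               dotPos T x ≡ (r , c) → dotPos T y ≡ (r′ , c′) → r < r′ × c ≡ c′ ⊎ r ≡ r′ × c′ < c →
               Below ((A ∷ʳ x) ++ d ∷ R) ((B ∷ʳ y) ++ d ∷ R)
  below-meet {A} {B} {x} {y} {d} {R} {r} {c} {r′} {c′} A∥ B∥ x≡ y≡ left = PQ left , QP left
    where
      val = λ ((r , c) : ℕ × ℕ) ((r′ , c′) : ℕ × ℕ) → (r′ <ᵇ r) ∨ (c <ᵇ c′)

      PQ : r < r′ × c ≡ c′ ⊎ r ≡ r′ × c′ < c → greaterB T ((A ∷ʳ x) ++ d ∷ R) ((B ∷ʳ y) ++ d ∷ R) ≡ false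
      PQ left rewrite trans (greaterB-meet A B A∥ B∥) (cong₂ val x≡ y≡) with left
      ... | inj₁ (r<r′ , refl) rewrite <ᵇ-false⁺ (<⇒≯ r<r′) = <ᵇ-false⁺ (n≮n c)
      ... | inj₂ (refl , c′<c) rewrite <ᵇ-false⁺ (n≮n r) = <ᵇ-false⁺ (<⇒≯ c′<c)

      QP : r < r′ × c ≡ c′ ⊎ r ≡ r′ × c′ < c → greaterB T ((B ∷ʳ y) ++ d ∷ R) ((A ∷ʳ x) ++ d ∷ R) ≡ true
      QP left rewrite trans (greaterB-meet B A B∥ A∥) (cong₂ val y≡ x≡) with left
      ... | inj₁ (r<r′ , refl) rewrite <ᵇ-true⁺ r<r′ = refl
      ... | inj₂ (refl , c′<c) rewrite <ᵇ-false⁺ (n≮n r) = <ᵇ-true⁺ c′<c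

  -- Sibling rows carry white dots of one column, the earlier one higher. Sibling columns carry
  -- black dots of one row, the earlier one further left.
  Sibling-positions : ∀ {x y} → Sibling x y → Label n (parent x) → ∃₂ λ r c → ∃₂ λ r′ c′ →
                      dotPos T x ≡ (r , c) × dotPos T y ≡ (r′ , c′) × (r < r′ × c ≡ c′ ⊎ r ≡ r′ × c′ < c)
  Sibling-positions (rows rx ry p≡ x<y) lp =
    _ , _ , _ , _ , dotPos-row rx lp , dotPos-row ry (subst (Label n) p≡ lp) , inj₁ (x<y , p≡)
  Sibling-positions (cols cx cy p≡ y<x) lp =
    _ , _ , _ , _ , dotPos-col cx , dotPos-col cy , inj₂ (p≡ , y<x)

  -- There are three cases. If `x` and `y` are unrestricted rows, the paths are disjoint and end in
  -- these rows. If their parent is an unrestricted row, the paths are disjoint and end at the black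
  -- dots `x` and `y`. Otherwise the parent is the first common dot.
  path-below : ∀ {a b x y} → Label n a → Label n (parent a) → Label n b → Label n (parent b) →
               a ⊑ x → b ⊑ y → Sibling x y → Below (path T a) (path T b)
  path-below {a} {b} {x} {y} la lpa lb lpb p q s with root⊎inner (⊑-label p la)
  path-below la lpa lb lpb p q (cols cx _ _ _) | inj₁ (rx , _) = contradiction rx (Col⇒¬Row cx)
  path-below la lpa lb lpb p q s@(rows rx ry p≡ x<y) | inj₁ (_ , px≡)
    with trail-last lpa p px≡ | trail-last lpb q (trans (sym p≡) px≡)
  ... | A , d , t≡ , ld , refl | B , e , t≡′ , le , refl =
    subst₂ Below (sym (trans (path-trail-root la lpa p px≡) t≡))
                 (sym (trans (path-trail-root lb lpb q (trans (sym p≡) px≡)) t≡′))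
      (below-disjoint
        (λ z∈A z∈B → Sibling-disjoint s (trail-⊑ p (subst (_ ∈_) (sym t≡) z∈A))
                                    (trail-⊑ q (subst (_ ∈_) (sym t≡′) z∈B)))
        (dotPos-col (child-of-row ld (⊑-label p la) rx)) (dotPos-col (child-of-row le (⊑-label q lb) ry)) (inj₁ x<y))
  path-below {a} {b} {x} {y} la lpa lb lpb p q s | inj₂ lpx
    with root⊎inner lpx | Sibling-positions s lpx | ⊑-label p la | ⊑-label q lb | Sibling-parent s
  ... | inj₁ (rp , pp≡) | _ , _ , _ , _ , x≡ , y≡ , left | lx | ly | p≡ =
    subst₂ Below (sym (proj₁ (path-top p lx lpx) pp≡))
                 (sym (proj₁ (path-top q ly (subst (Label n) p≡ lpx)) (trans (cong parent (sym p≡)) pp≡)))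
      (below-disjoint {trail p} {trail q} (λ z∈A z∈B → Sibling-disjoint s (trail∷ʳ-⊑ p z∈A) (trail∷ʳ-⊑ q z∈B))
        x≡ y≡ (map₁ proj₁ left))
  ... | inj₂ lpp        | _ , _ , _ , _ , x≡ , y≡ , left | lx | ly | p≡ with path-head lpx lpp
  ...   | R , c≡ =
    subst₂ Below (sym a≡) (sym b≡)
      (below-meet {trail p} {trail q}
        -- A dot of the trail up to `x` that lies on the path of `b` would put `b` under `x` as well
        -- as under `y`.
        (λ z∈A z∈Q → Sibling-disjoint s (⊑-trans (∈-path⁻ lb lpb (subst (_ ∈_) (sym b≡) z∈Q)) (trail∷ʳ-⊑ p z∈A)) q)
        (λ z∈B z∈P → Sibling-disjoint s p (⊑-trans (∈-path⁻ la lpa (subst (_ ∈_) (sym a≡) z∈P)) (trail∷ʳ-⊑ q z∈B)))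
        x≡ y≡ left)
    where
      a≡ : path T a ≡ (trail p ∷ʳ x) ++ parent x ∷ R
      a≡ = trans (proj₂ (path-top p lx lpx) lpp) (cong ((trail p ∷ʳ x) ++_) c≡)

      b≡ : path T b ≡ (trail q ∷ʳ y) ++ parent x ∷ R
      b≡ = trans (proj₂ (path-top q ly (subst (Label n) p≡ lpx)) (subst (Label n) (cong parent p≡) lpp))
                 (cong ((trail q ∷ʳ y) ++_) (trans (cong (path T) (sym p≡)) c≡))

  -- If `j` preceded `k`, then either `k` would be an ancestor of `j` and lie on its path, or the
  -- path of `j` would be the smaller one. The negative conclusion fits the later use, where the
  -- word fixes which of two entries comes first.
  inversion⁻ : ∀ {j k} → Label n j → Label n k → isInversion T j k ≡ true → Col j × j < k × ¬ j ≺ k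
  inversion⁻ {j} {k} lj lk e
    with c , e₁ ← ∧-true⁻ e
    with j<k , e₂ ← ∧-true⁻ e₁
    with dot , e₃ ← ∧-true⁻ e₂
    with k∉ , e₄ ← ∧-true⁻ e₃
    with _ , e₅ ← ∧-true⁻ {not (containsB T (path T j) (path T k))} e₄
    with _ , isGreater ← ∧-true⁻ {not (containsB T (path T k) (path T j))} e₅ = not-injective c , <ᵇ-true⁻ j<k , ¬j≺k
    where
      lpj = proj₁ (parent-col lj (not-injective c))
      lpk = isDotLabel⁻ lk dot
      ¬j≺k : ¬ j ≺ k
      ¬j≺k (descend j⊏k) with () ← trans (sym k∉) (cong not (elemB⁺ (∈-path⁺ (⊏⇒⊑ j⊏k) lk lpk)))
      ¬j≺k (branch p q s) with () ← trans (sym isGreater) (proj₁ (path-below lj lpj lk lpk p q s))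

  -- The doubtful case is a row `k` that is itself the earlier sibling. All labels under the later
  -- row `y` are at least `y`, so `k < y ≤ j`, against `j < k`.
  branch-inner : ∀ {j k x y} → Label n j → Label n k → j < k → k ⊑ x → j ⊑ y → Sibling x y → Label n (parent k)
  branch-inner lj lk j<k (up _ lp _) q s                   = lp
  branch-inner lj lk j<k done        q (cols ck _ _ _)     = proj₁ (parent-col lk ck)
  branch-inner lj lk j<k done        q (rows _ ry _ k<y) =
    contradiction (<-trans j<k k<y) (≤⇒≯ (≤-trans (subst (_≤ lo _) (lo-row ry) (lo-anti q)) (lo≤ lj)))

  inversion⁺ : ∀ {j k} → Label n j → Label n k → Col j → j < k → k ≺ j → isInversion T j k ≡ true
  -- A descendant of a column is at most that column, by monotonicity of `hi`.
  inversion⁺ {j} {k} lj lk c j<k (descend k⊏j) =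
    contradiction (≤-trans (≤hi lk) (subst (hi k ≤_) (hi-col c) (hi-mono (⊏⇒⊑ k⊏j)))) (<⇒≱ j<k)
  inversion⁺ {j} {k} lj lk c j<k (branch p q s) =
    ∧-true⁺ (cong not c) (∧-true⁺ (<ᵇ-true⁺ j<k) (∧-true⁺ (isDotLabel⁺ lk lpk)
      (∧-true⁺ (cong not (elemB-false k∉)) (∧-true⁺ (cong not (¬-not ¬j⊇k)) (∧-true⁺ (cong not (¬-not ¬k⊇j))
        (proj₂ (path-below lk lpk lj lpj p q s)))))))
    where
      lpj = proj₁ (parent-col lj c)

      lpk = branch-inner lj lk j<k p q s

      k∉ : k ∉ path T j
      k∉ k∈ = Sibling-disjoint s (⊑-trans (∈-path⁻ lj lpj k∈) p) q

      ¬j⊇k : containsB T (path T j) (path T k) ≢ true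
      ¬j⊇k e with R , k≡ ← path-head lk lpk = k∉ (containsB⇒∈ _ (subst (λ Q → containsB T (path T j) Q ≡ true) k≡ e))

      ¬k⊇j : containsB T (path T k) (path T j) ≢ true
      ¬k⊇j e with R , j≡ ← path-head lj lpj =
        Sibling-disjoint s p (⊑-trans (∈-path⁻ lk lpk
          (containsB⇒∈ _ (subst (λ Q → containsB T (path T k) Q ≡ true) j≡ e))) q)

-- Sums, counts and positions in lists.

sumL-↭ : ∀ {xs ys} → xs ↭ ys → sumL xs ≡ sumL ys
sumL-↭ ↭.refl          = refl
sumL-↭ (↭.prep x p)    = cong (x +_) (sumL-↭ p)
sumL-↭ (↭.swap {xs} {ys} x y p)  = begin
  x + (y + sumL xs)  ≡⟨ +-assoc x y _ ⟨
  x + y + sumL xs    ≡⟨ cong₂ _+_ (+-comm x y) (sumL-↭ p) ⟩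
  y + x + sumL ys    ≡⟨ +-assoc y x _ ⟩
  y + (x + sumL ys)  ∎
  where open ≡-Reasoning
sumL-↭ (↭.trans p q)   = trans (sumL-↭ p) (sumL-↭ q)

module _ {A : Set} where

  countB-↭ : ∀ (p : A → Bool) {xs ys} → xs ↭ ys → countB p xs ≡ countB p ys
  countB-↭ p ↭.refl = refl
  countB-↭ p (↭.prep x r) with p x
  ... | true  = cong suc (countB-↭ p r)
  ... | false = countB-↭ p r
  countB-↭ p (↭.swap x y r) with p x | p y
  ... | true  | true  = cong (suc ∘ suc) (countB-↭ p r)
  ... | true  | false = cong suc (countB-↭ p r)
  ... | false | true  = cong suc (countB-↭ p r)
  ... | false | false = countB-↭ p r
  countB-↭ p (↭.trans r s) = trans (countB-↭ p r) (countB-↭ p s)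

  countB-cong : ∀ {p q : A → Bool} {xs} → (∀ {x} → x ∈ xs → p x ≡ q x) → countB p xs ≡ countB q xs
  countB-cong {xs = []}     _  = refl
  countB-cong {q = q} {xs = x ∷ xs} eq rewrite eq (here refl) with q x
  ... | true  = cong suc (countB-cong (eq ∘ there))
  ... | false = countB-cong (eq ∘ there)

  countB-map : ∀ {B : Set} (p : A → Bool) (f : B → A) xs → countB p (map f xs) ≡ countB (p ∘ f) xs
  countB-map p f []       = refl
  countB-map p f (x ∷ xs) with p (f x)
  ... | true  = cong suc (countB-map p f xs)
  ... | false = countB-map p f xs

  AllPairs-reverse : ∀ {R : Rel A 0ℓ} {xs} → AllPairs R xs → AllPairs (flip R) (reverse xs)
  AllPairs-reverse []                        = []
  AllPairs-reverse {R} {x ∷ xs} (rx ∷ rs) =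
    subst (AllPairs (flip R)) (sym (unfold-reverse x xs))
      (AllPairs.++⁺ (AllPairs-reverse rs) ([] ∷ []) (All.tabulate λ y∈ →
        All.lookup rx (∈-resp-↭ (↭-reverse xs) y∈) ∷ []))

  Linked-reverse : ∀ {R : Rel A 0ℓ} {xs} → Linked R xs → Linked (flip R) (reverse xs)
  Linked-reverse []                 = []
  Linked-reverse {R} {x ∷ xs} rs = go rs [-]
    where
      go : ∀ {x xs acc} → Linked R (x ∷ xs) → Linked (flip R) (x ∷ acc) → Linked (flip R) (reverseAcc (x ∷ acc) xs)
      go [-]      ls = ls
      go (r ∷ rs) ls = go rs (r ∷ ls)

-- at is 1-indexed.
at-All : ∀ {P : ℕ → Set} {xs i} → All P xs → Label (length xs) i → P (at xs i)
at-All {i = suc zero}    (p ∷ ps) _               = p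
at-All {i = suc (suc i)} (p ∷ ps) (_ , s≤s i<) = at-All ps (s≤s z≤n , i<)

at-AllPairs : ∀ {R : Rel ℕ 0ℓ} {xs i k} → AllPairs R xs → 1 ≤ i → i < k → k ≤ length xs → R (at xs i) (at xs k)
at-AllPairs {i = suc zero}    {suc (suc k)} (rx ∷ _)  _ _         (s≤s k≤) = at-All rx (s≤s z≤n , k≤)
at-AllPairs {i = suc zero}    {suc zero}    _         _ (s≤s ())
at-AllPairs {i = suc (suc i)} {suc (suc k)} (_ ∷ rs)  _ (s≤s i<k) (s≤s k≤) = at-AllPairs rs (s≤s z≤n) i<k k≤

at-Linked : ∀ {R : Rel ℕ 0ℓ} {xs i} → Linked R xs → 1 ≤ i → i < length xs → R (at xs i) (at xs (suc i))
at-Linked {i = suc zero}    (r ∷ _)  _ _        = r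
at-Linked {i = suc zero}    [-]  _ (s≤s ())
at-Linked {i = suc (suc i)} (_ ∷ rs) _ (s≤s i<) = at-Linked rs (s≤s z≤n) i<

at-map : ∀ f xs {i} → Label (length xs) i → at (map f xs) i ≡ f (at xs i)
at-map f (x ∷ xs) {suc zero}    _            = refl
at-map f (x ∷ xs) {suc (suc i)} (_ , s≤s i<) = at-map f xs (s≤s z≤n , i<)

map-at : ∀ xs → map (at xs) (labels (length xs)) ≡ xs
map-at []       = refl
map-at (x ∷ xs) = cong (x ∷_) (begin
  map (at (x ∷ xs)) (map suc (applyUpTo suc (length xs)))
    ≡⟨ cong (map (at (x ∷ xs)) ∘ map suc) (map-upTo suc (length xs)) ⟨
  map (at (x ∷ xs)) (map suc (labels (length xs)))
    ≡⟨ map-∘ (labels (length xs)) ⟨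
  map (at (x ∷ xs) ∘ suc) (labels (length xs))
    ≡⟨ map-cong-local (All.tabulate shift) ⟩
  map (at xs) (labels (length xs))
    ≡⟨ map-at xs ⟩
  xs
    ∎)
  where
    open ≡-Reasoning
    shift : ∀ {i} → i ∈ labels (length xs) → at (x ∷ xs) (suc i) ≡ at xs i
    -- The match makes the position positive; at 0 the right side would be the default value of
    -- `at`.
    shift i∈ with s≤s _ , _ ← ∈-labels⁻ {length xs} i∈ = refl

true⇔true⇒≡ : ∀ {x y} → (x ≡ true → y ≡ true) → (y ≡ true → x ≡ true) → x ≡ y
true⇔true⇒≡ {true}          f g = sym (f refl)
true⇔true⇒≡ {false} {true}  f g = g refl
true⇔true⇒≡ {false} {false} f g = refl

-- Inversions as pattern occurrences.

module Count {n} (T : PermTableau n) where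
  open Tableau T
  open Paths T

  -- Irreflexivity of `≺` excludes repetitions, and at threshold 0 every label is due because its
  -- `hi` is positive.
  ξ↭labels : ξ T ↭ labels n
  ξ↭labels = ∼bag⇒↭ (unique∧set⇒bag
    (AllPairs.map (λ {x} x≺y x≡y → ≺-irrefl (subst (x ≺_) (sym x≡y) x≺y)) (ordered stage-ξ))
    (AllPairs.map <⇒≢ (labels-sorted n))
    (mk⇔ (∈-labels⁺ ∘ proj₁ ∘ sound stage-ξ)
         (λ k∈ → let l = ∈-labels⁻ k∈ in complete stage-ξ l (≤-trans (proj₁ l) (≤hi l)))))

  ρ : List ℕ
  ρ = reverse (ξ T)

  ρ↭labels : ρ ↭ labels n
  ρ↭labels = ↭.↭-trans (↭-reverse (ξ T)) ξ↭labels

  length-ρ : length ρ ≡ n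
  length-ρ = trans (↭-length ρ↭labels) (trans (length-map suc (upTo n)) (length-upTo n))

  position : ∀ {i} → Label n i → Label (length ρ) i
  position = subst (λ m → Label m _) (sym length-ρ)

  ρ-label : ∀ {i} → Label n i → Label n (at ρ i)
  ρ-label l = at-All (All.tabulate (∈-labels⁻ ∘ ∈-resp-↭ ρ↭labels)) (position l)

  ρ-ordered : ∀ {i k} → Label n i → Label n k → i < k → at ρ k ≺ at ρ i
  ρ-ordered (1≤i , _) lk i<k = at-AllPairs (AllPairs-reverse (ordered stage-ξ)) 1≤i i<k (proj₂ (position lk))

  -- Reversal turns the successor in the word into the left neighbour. The `suc n` in front shifts
  -- positions by one and gives the first entry a neighbour too.
  ρ-linked : ∀ {i} → Label n i → at (suc n ∷ ρ) (suc i) ⋖ at (suc n ∷ ρ) i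
  ρ-linked l@(1≤i , _) =
    at-Linked (subst (Linked (flip _⋖_)) (reverse-++ (ξ T) [ suc n ]) (Linked-reverse (linked stage-ξ)))
      1≤i (s≤s (proj₂ (position l)))

  σ : List ℕ
  σ = reverseComplement n (ξ T)

  at-σ : ∀ {i} → Label n i → at σ i ≡ suc n ∸ at ρ i
  at-σ l = at-map (suc n ∸_) ρ (position l)

  σ-< : ∀ {i k} → Label n i → Label n k → at ρ i < at ρ k → at σ k < at σ i
  σ-< li lk lt = subst₂ _<_ (sym (at-σ lk)) (sym (at-σ li)) (∸-monoʳ-< lt (m≤n⇒m≤1+n (proj₂ (ρ-label lk))))

  ρ-< : ∀ {i k} → Label n i → Label n k → at σ k < at σ i → at ρ i < at ρ k
  ρ-< li lk lt = ∸-cancelʳ-< (subst₂ _<_ (at-σ lk) (at-σ li) lt)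

  is32-1 : ℕ → ℕ → Bool
  is32-1 i k = (2 ≤ᵇ i) ∧ (i <ᵇ k) ∧ (at σ i <ᵇ at σ (i ∸ 1)) ∧ (at σ k <ᵇ at σ i)

  -- The descent in `σ` makes `at ρ i` a descent top of `ξ T`, hence a column; `i < k` places
  -- `at ρ k` before it in `ξ T`.
  pattern⇒inversion : ∀ {i k} → Label n i → Label n k → is32-1 i k ≡ true → isInversion T (at ρ i) (at ρ k) ≡ true
  pattern⇒inversion {suc (suc i)} {k} li lk e =
    let i<k , e₁ = ∧-true⁻ e ; descent , σk<σi = ∧-true⁻ e₁
    in inversion⁺ (ρ-label li) (ρ-label lk) (col (ρ-linked li) (ρ-< lp li (<ᵇ-true⁻ descent)))
         (ρ-< li lk (<ᵇ-true⁻ σk<σi)) (ρ-ordered li lk (<ᵇ-true⁻ i<k))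
    where
      lp : Label n (suc i)
      lp = s≤s z≤n , <⇒≤ (proj₂ li)
      col : ∀ {a b} → a ⋖ b → b < a → Col a
      col (inj₁ (_ , a<b)) b<a = contradiction b<a (<⇒≯ a<b)
      col (inj₂ (c , _))   _   = c

  inversion⇒pattern : ∀ {i k} → Label n i → Label n k → isInversion T (at ρ i) (at ρ k) ≡ true → is32-1 i k ≡ true
  inversion⇒pattern {i} {k} li lk e with inversion⁻ (ρ-label li) (ρ-label lk) e
  ... | c , j<l , ¬j≺l with <-cmp i k
  ...   | tri≈ _ refl _ = contradiction j<l (<-irrefl refl)
  ...   | tri> _ _ k<i  = contradiction (ρ-ordered lk li k<i) ¬j≺l
  ...   | tri< i<k _ _  = go i li c j<l i<k
    where
      descent : ∀ {a b} → a ⋖ b → Col a → b < a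
      descent (inj₁ (r , _))   c = contradiction r (Col⇒¬Row c)
      descent (inj₂ (_ , b<a)) _ = b<a

      go : ∀ i → Label n i → Col (at ρ i) → at ρ i < at ρ k → i < k → is32-1 i k ≡ true
      -- At position 1 the neighbour is `suc n`, and a column there would have to exceed it. This
      -- accounts for the bound `2 ≤ i` in the pattern.
      go (suc zero)    li c _   _   = contradiction (descent (ρ-linked li) c) (≤⇒≯ (m≤n⇒m≤1+n (proj₂ (ρ-label li))))
      go (suc (suc i)) li c j<l i<k =
        ∧-true⁺ (<ᵇ-true⁺ i<k)
          (∧-true⁺ (<ᵇ-true⁺ (σ-< (s≤s z≤n , <⇒≤ (proj₂ li)) li (descent (ρ-linked li) c)))
            (<ᵇ-true⁺ (σ-< li lk j<l)))

  map-at-ρ : map (at ρ) (labels n) ≡ ρ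
  map-at-ρ = subst (λ m → map (at ρ) (labels m) ≡ ρ) length-ρ (map-at ρ)

  inversionsAt : ℕ → ℕ
  inversionsAt j = countB (isInversion T j) (labels n)

  -- Positions `k` correspond to labels `at ρ k`, and a count over all labels does not depend on
  -- their order.
  pattern-count : ∀ {i} → i ∈ labels n → countB (is32-1 i) (labels n) ≡ inversionsAt (at ρ i)
  pattern-count {i} i∈ = begin
    countB (is32-1 i) (labels n)
      ≡⟨ countB-cong (λ k∈ → let li = ∈-labels⁻ i∈ ; lk = ∈-labels⁻ k∈ in
           true⇔true⇒≡ (pattern⇒inversion li lk) (inversion⇒pattern li lk)) ⟩
    countB (isInversion T (at ρ i) ∘ at ρ) (labels n)
      ≡⟨ countB-map (isInversion T (at ρ i)) (at ρ) (labels n) ⟨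
    countB (isInversion T (at ρ i)) (map (at ρ) (labels n))
      ≡⟨ cong (countB (isInversion T (at ρ i))) map-at-ρ ⟩
    countB (isInversion T (at ρ i)) ρ
      ≡⟨ countB-↭ _ ρ↭labels ⟩
    inversionsAt (at ρ i)
      ∎
    where open ≡-Reasoning

theorem2p1 : (n : ℕ) (T : PermTableau n) →
    inv T ≡ f32-1 n (reverseComplement n (ξ T))
theorem2p1 n T = begin
  sumL (map inversionsAt (labels n))                        ≡⟨ sumL-↭ (↭-map⁺ inversionsAt ρ↭labels) ⟨
  sumL (map inversionsAt ρ)                                 ≡⟨ cong (sumL ∘ map inversionsAt) map-at-ρ ⟨
  sumL (map inversionsAt (map (at ρ) (labels n)))           ≡⟨ cong sumL (map-∘ (labels n)) ⟨
  sumL (map (inversionsAt ∘ at ρ) (labels n))               ≡⟨ cong sumL (map-cong-local (All.tabulate pattern-count)) ⟨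
  sumL (map (λ i → countB (is32-1 i) (labels n)) (labels n)) ∎
  where
    open ≡-Reasoning
    open Count T
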